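{- For all $m,n\ge 1$ one has $K_{m,n}(x,y)=K_{m,n}(y,x)$.
   Context: Let $m,n\ge 1$. $K_{m,n}$ is the complete bipartite graph with vertex set $V=A_m\sqcup B_n$, $A_m=\{a_1,\dots,a_m\}$, $B_n=\{b_1,\dots,b_n\}$, with exactly one edge $\{a_i,b_j\}$ for every $i,j$; $a_m$ is the sink. A configuration is a function $u:V\to\mathbb Z$; $\mathrm{degree}(u)=\sum_c u_c$. For $c\in V$ with graph degree $d_c$, $\Delta^{(c)}=d_c e_c-\sum_{c'\text{ adjacent to }c}e_{c'}$ ($e_c$ the indicator of $c$), $\Delta^{(C)}=\sum_{c\in C}\Delta^{(c)}$. Toppling equivalence: difference in the integer span of the $\Delta^{(c)}$; effective: toppling equivalent to a non-negative configuration; $\mathrm{rank}(u)=-1+\min\{\mathrm{degree}(f): f\ge0,\ u-f\text{ not effective}\}$. $u$ is parking if $u_c\ge0$ for $c\ne a_m$ and for every non-empty $C\subseteq V\setminus\{a_m\}$, $u-\Delta^{(C)}$ has a negative value at a vertex other than $a_m$; sorted if $u_{a_1}\le\dots\le u_{a_{m-1}}$ and $u_{b_1}\le\dots\le u_{b_n}$ (no condition at the sink). For a parking sorted $u$ set $\mathrm{xpara}(u)=(m-1)(n-1)+\mathrm{rank}(u)-\mathrm{degree}(u)$ and $\mathrm{ypara}(u)=\mathrm{rank}(u)+1$ (both are non-negative integers). Define the formal power series $K_{m,n}(x,y)=\sum_u x^{\mathrm{xpara}(u)}y^{\mathrm{ypara}(u)}$, the sum over all parking sorted configurations $u$ on $K_{m,n}$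 (all sink values allowed); equivalently $K_{m,n}(x,y)=x^{(m-1)(n-1)}y\,\widetilde K_{m,n}(x^{ -1},xy)$ where $\widetilde K_{m,n}(d,r)=\sum_u d^{\mathrm{degree}(u)}r^{\mathrm{rank}(u)}$. -}

module Defs where

open import Data.Bool using (Bool; true; false; if_then_else_)
open import Data.Fin as Fin using (Fin; zero; suc; toℕ)
import Data.Fin.Properties as Fin
open import Data.Integer using (ℤ; +_; _+_; _-_; _*_; _≤_; _<_; 0ℤ; 1ℤ; -1ℤ)
open import Data.Integer.Properties using (+-0-monoid)
open import Data.List using (List; _∷_; length; lookup)
import Data.List.Membership.Setoid as Membership
open import Data.List.Membership.Propositional.Properties using (∈-lookup)
open import Data.List.Membership.Setoid.Properties using (index-injective)
import Data.List.Relation.Unary.Any as Any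
open import Data.List.Relation.Unary.All as All using (All)
open import Data.List.Relation.Unary.AllPairs using (_∷_)
import Data.List.Relation.Unary.Unique.Setoid as Unique
open import Data.Nat as ℕ using (ℕ)
import Data.Nat.Properties as ℕ
open import Data.Product using (_×_; ∃; ∃₂; _,_)
open import Data.Sum using (_⊎_; inj₁; inj₂)
open import Data.Sum.Properties using (≡-dec)
open import Relation.Binary.Bundles using (Setoid)
open import Relation.Binary.PropositionalEquality using (_≡_; refl; cong; _→-setoid_)
open import Relation.Nullary using (¬_; Dec; does; contradiction)

open import Algebra.Properties.Monoid.Sum +-0-monoid using (sum)

-- inj₁ i is the vertex a_{i+1} and inj₂ j the vertex b_{j+1}.
Vertex : ℕ → ℕ → Set
Vertex m n = Fin m ⊎ Fin n

-- Only a_m satisfies this predicate.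
data IsSink {m n : ℕ} : Vertex m n → Set where
  last : {i : Fin m} → ℕ.suc (toℕ i) ≡ m → IsSink (inj₁ i)

_≟_ : ∀ {m n} (c c′ : Vertex m n) → Dec (c ≡ c′)
_≟_ = ≡-dec Fin._≟_ Fin._≟_

adjacent : ∀ {m n} → Vertex m n → Vertex m n → Bool
adjacent (inj₁ _) (inj₂ _) = true
adjacent (inj₂ _) (inj₁ _) = true
adjacent (inj₁ _) (inj₁ _) = false
adjacent (inj₂ _) (inj₂ _) = false

-- Configurations are compared pointwise, since functions are not extensional.
Config : ℕ → ℕ → Set
Config m n = Vertex m n → ℤ

configSetoid : ℕ → ℕ → Setoid _ _
configSetoid m n = Vertex m n →-setoid ℤ

∑ : ∀ {m n} → (Vertex m n → ℤ) → ℤ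
∑ f = sum (λ i → f (inj₁ i)) + sum (λ j → f (inj₂ j))

degree : ∀ {m n} → Config m n → ℤ
degree u = ∑ u

indicator : Bool → ℤ
indicator p = if p then 1ℤ else 0ℤ

-- The graph degree d_c of a vertex.
valency : ∀ {m n} → Vertex m n → ℤ
valency c = ∑ (λ c′ → indicator (adjacent c c′))

Δ : ∀ {m n} → Vertex m n → Config m n
Δ c c′ = valency c * indicator (does (c ≟ c′)) - indicator (adjacent c c′)

-- Sets of vertices are given by their characteristic functions.
Δ-set : ∀ {m n} → (Vertex m n → Bool) → Config m n
Δ-set C c′ = ∑ (λ c → indicator (C c) * Δ c c′)

_∼_ : ∀ {m n} → Config m n → Config m n → Set
_∼_ {m} {n} u v =
  ∃ λ (k : Vertex m n → ℤ) → ∀ c′ → u c′ - v c′ ≡ ∑ (λ c → k c * Δ c c′)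

NonNegative : ∀ {m n} → Config m n → Set
NonNegative u = ∀ c → 0ℤ ≤ u c

Effective : ∀ {m n} → Config m n → Set
Effective {m} {n} u = ∃ λ (v : Config m n) → NonNegative v × u ∼ v

IsMinimum : (ℤ → Set) → ℤ → Set
IsMinimum P d = P d × (∀ d′ → P d′ → d ≤ d′)

IsRank : ∀ {m n} → Config m n → ℤ → Set
IsRank {m} {n} u r = ∃ λ d → IsMinimum DegreeOfObstruction d × r ≡ -1ℤ + d
  where
  DegreeOfObstruction : ℤ → Set
  DegreeOfObstruction d = ∃ λ (f : Config m n) →
    NonNegative f × ¬ Effective (λ c → u c - f c) × degree f ≡ d

Parking : ∀ {m n} → Config m n → Set
Parking {m} {n} u =
  (∀ c → ¬ IsSink c → 0ℤ ≤ u c) ×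
  (∀ (C : Vertex m n → Bool) →
    (∃ λ c → C c ≡ true) →
    (∀ c → C c ≡ true → ¬ IsSink c) →
    ∃ λ c → ¬ IsSink c × u c - Δ-set C c < 0ℤ)

Sorted : ∀ {m n} → Config m n → Set
Sorted {m} {n} u =
  (∀ (i i′ : Fin m) → ¬ IsSink {m} {n} (inj₁ i) → ¬ IsSink {m} {n} (inj₁ i′) →
    i Fin.≤ i′ → u (inj₁ i) ≤ u (inj₁ i′)) ×
  (∀ (j j′ : Fin n) → j Fin.≤ j′ → u (inj₂ j) ≤ u (inj₂ j′))

ParkingSorted : ∀ {m n} → Config m n → Set
ParkingSorted u = Parking u × Sorted u

-- The parameters xpara and ypara of u, as functions of u and r = rank(u).
xpara : ∀ {m n} → Config m n → ℤ → ℤ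
xpara {m} {n} u r = (+ m - 1ℤ) * (+ n - 1ℤ) + r - degree u

ypara : ℤ → ℤ
ypara r = r + 1ℤ

-- The monomial contributed by u is x^i y^j.
HasMonomial : ∀ {m n} → Config m n → ℕ → ℕ → Set
HasMonomial u i j = ∃ λ r → IsRank u r × xpara u r ≡ + i × ypara r ≡ + j

-- P holds for exactly N configurations, counted up to pointwise equality.
Count : ∀ {m n} → (Config m n → Set) → ℕ → Set
Count {m} {n} P N = ∃ λ (us : List (Config m n)) →
  Unique us × All P us × (∀ u → P u → u ∈ us) × length us ≡ N
  where
  open Unique (configSetoid m n) using (Unique)
  open Membership (configSetoid m n) using (_∈_)

-- A series in x and y, given by the coefficients of the monomials x^i y^j.
PowerSeries : Set
PowerSeries = ℕ → ℕ → ℕ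

-- K = ∑_u x^xpara(u) y^ypara(u).  The first component says that every summand
-- is a monomial (the rank exists and both exponents are natural numbers), so
-- that no u is left out of the counts in the second one, which says that
-- coefficients are finite.  K is determined by these conditions: see IsK-unique.
IsK : (m n : ℕ) → PowerSeries → Set
IsK m n K =
  (∀ (u : Config m n) → ParkingSorted u → ∃₂ λ i j → HasMonomial u i j) ×
  (∀ i j → Count {m} {n} (λ u → ParkingSorted u × HasMonomial u i j) (K i j))

module _ {m n : ℕ} where
  private
    S = configSetoid m n
    open Setoid S using (_≈_)
    module S = Setoid S
  open Unique S using (Unique)

  lookup-injective : ∀ {us} → Unique us → ∀ {k l} → lookup us k ≈ lookup us l → k ≡ l
  lookup-injective (_ ∷ _)  {zero}  {zero}  _  = refl
  lookup-injective (p ∷ _)  {zero}  {suc l} eq = contradiction eq (All.lookup p (∈-lookup l))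
  lookup-injective (p ∷ _)  {suc k} {zero}  eq = contradiction (S.sym eq) (All.lookup p (∈-lookup k))
  lookup-injective (_ ∷ ps) {suc k} {suc l} eq = cong suc (lookup-injective ps eq)

  Count-≤ : ∀ {P : Config m n → Set} {N N′} → Count P N → Count P N′ → N ℕ.≤ N′
  Count-≤ (us , unique , all , _ , refl) (vs , _ , _ , complete , refl) =
    Fin.injective⇒≤ {f = λ k → Any.index (position k)} λ {k} {l} eq →
      lookup-injective unique (index-injective S (position k) (position l) eq)
    where
    position = λ k → complete (lookup us k) (All.lookup all (∈-lookup k))

  Count-unique : ∀ {P : Config m n → Set} {N N′} → Count P N → Count P N′ → N ≡ N′
  Count-unique p q = ℕ.≤-antisym (Count-≤ p q) (Count-≤ q p)

IsK-unique : ∀ {m n K K′} → IsK m n K → IsK m n K′ → ∀ i j → K i j ≡ K′ i j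
IsK-unique (_ , p) (_ , q) i j = Count-unique (p i j) (q i j)

{-# OPTIONS --safe #-}

-- The exponents of u are xpara u = rank (κ - u) + 1 and ypara u = rank u + 1,
-- where κ is the canonical configuration, c ↦ d_c - 2: this is the
-- Riemann-Roch theorem of Baker and Norine.  Hence u ↦ κ - u, followed by
-- passing to the parking representative and sorting it, exchanges the exponents.
-- It is injective on parking sorted configurations: they form a system of
-- representatives for toppling equivalence modulo the permutations of the
-- vertices that preserve the sink and the two sides, all of which fix κ.
--
-- For Riemann-Roch, an order on the vertices yields ν(c) = (number of
-- neighbours before c) - 1, which is never effective, while the order in which
-- Dhar's algorithm burns a parking configuration with negative sink value gives
-- a ν above it; and reversing the order turns ν into κ - ν.

module Submission where

open import Defs
open import Data.Bool using (Bool; true; false; not; if_then_else_)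
open import Data.Fin as Fin using (Fin; zero; suc; toℕ)
import Data.Fin.Properties as Fin
open import Data.Fin.Permutation as Perm using (Permutation′; _⟨$⟩ʳ_; _⟨$⟩ˡ_)
open import Data.Integer as ℤ using (ℤ; +_; -[1+_]; _+_; _-_; _*_; -_; 0ℤ; 1ℤ; -1ℤ)
import Data.Integer.Properties as ℤ
open import Data.Integer.Tactic.RingSolver using (solve-∀)
open import Data.List as List using (List; []; _∷_)
open import Data.List.Relation.Unary.All as All using (All; []; _∷_)
open import Data.List.Relation.Unary.All.Properties using (all-filter; deduplicate⁺)
open import Data.List.Relation.Unary.Unique.DecSetoid.Properties using (deduplicate-!)
open import Data.List.Relation.Unary.Any as Any using (Any)
open import Data.List.Membership.Propositional using (_∈_; find; lose)
open import Data.List.Membership.Propositional.Properties using (∈-++⁺ˡ; ∈-++⁺ʳ; ∈-map⁺; ∈-allFin; ∈-lookup)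
open import Data.List.Membership.Setoid.Properties using (index-injective; ∈-filter⁺; ∈-deduplicate⁺)
open import Data.Nat as ℕ using (ℕ; _≤_)
import Data.Nat.Properties as ℕ
open import Data.Product using (∃; ∃₂; _×_; _,_; proj₁; proj₂)
open import Data.Sum using (_⊎_; inj₁; inj₂; [_,_])
open import Data.Sum.Properties using (inj₁-injective)
open import Data.Unit using (⊤)
open import Function using (_∘_)
open import Function.Bundles using (Injection)
open import Function.Properties.Inverse using (↔⇒↣)
open import Relation.Binary.PropositionalEquality
  using (_≡_; _≢_; _≗_; refl; sym; trans; cong; cong₂; subst; subst₂; module ≡-Reasoning)
open import Relation.Binary.Bundles using (Setoid; DecSetoid)
open import Relation.Binary.Definitions using (tri<; tri≈; tri>)
open import Relation.Nullary using (¬_; Dec; yes; no; does; contradiction)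
open import Relation.Nullary.Decidable using (¬?; _×-dec_; _→-dec_; map′)

open import Algebra.Properties.Monoid.Sum ℤ.+-0-monoid using (sum; sum-cong-≗)
import Algebra.Properties.Semiring.Sum ℤ.+-*-semiring as Sum

-- Sums over the vertices

-- One maximum principle, `first-maximum`, carries the combinatorics. Applied to a firing vector it
-- shows that no `ν` is effective and that parking representatives are unique; applied to the
-- indicator of a set it shows that a burning order certifies parking. Such an order is easily
-- reversed or permuted, whereas the definition of parking quantifies over sets.
--
-- `IsK` asks for ranks and counts outright, so effectiveness has to be decided: what decides it is
-- the sign of the sink value of the parking representative. A rank is then found by searching a
-- finite box, and a coefficient is finite because its two exponents fix the degree while parking
-- bounds every value except the one at the sink.

sum-mono : ∀ {n} {f g : Fin n → ℤ} → (∀ i → f i ℤ.≤ g i) → sum f ℤ.≤ sum g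
sum-mono {ℕ.zero}  f≤g = ℤ.≤-refl
sum-mono {ℕ.suc n} f≤g = ℤ.+-mono-≤ (f≤g zero) (sum-mono (f≤g ∘ suc))

sum-zero : ∀ n → sum {n} (λ _ → 0ℤ) ≡ 0ℤ
sum-zero = Sum.sum-replicate-zero

sum-const : ∀ n x → sum {n} (λ _ → x) ≡ + n * x
sum-const ℕ.zero    x = sym (ℤ.*-zeroˡ x)
sum-const (ℕ.suc n) x = trans (cong (_+_ x) (sum-const n x)) (eq x (+ n))
  where
  eq : ∀ x k → x + k * x ≡ (1ℤ + k) * x
  eq = solve-∀

sum-δ : ∀ {n} (f : Fin n → ℤ) j → sum (λ i → f i * indicator (does (i Fin.≟ j))) ≡ f j
sum-δ {ℕ.suc n} f zero = begin
  f zero * 1ℤ + sum (λ i → f (suc i) * 0ℤ)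
    ≡⟨ cong₂ _+_ (ℤ.*-identityʳ (f zero)) (sum-cong-≗ (λ i → ℤ.*-zeroʳ (f (suc i)))) ⟩
  f zero + sum {n} (λ _ → 0ℤ)
    ≡⟨ cong (_+_ (f zero)) (sum-zero n) ⟩
  f zero + 0ℤ
    ≡⟨ ℤ.+-identityʳ (f zero) ⟩
  f zero ∎
  where open ≡-Reasoning
sum-δ {ℕ.suc n} f (suc j) = begin
  f zero * 0ℤ + sum (λ i → f (suc i) * indicator (does (i Fin.≟ j)))
    ≡⟨ cong₂ _+_ (ℤ.*-zeroʳ (f zero)) (sum-δ (f ∘ suc) j) ⟩
  0ℤ + f (suc j)
    ≡⟨ ℤ.+-identityˡ (f (suc j)) ⟩
  f (suc j) ∎
  where open ≡-Reasoning

module _ {m n : ℕ} where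

  ∑-cong : {f g : Vertex m n → ℤ} → f ≗ g → ∑ f ≡ ∑ g
  ∑-cong f≗g = cong₂ _+_ (sum-cong-≗ (f≗g ∘ inj₁)) (sum-cong-≗ (f≗g ∘ inj₂))

  ∑-mono : {f g : Vertex m n → ℤ} → (∀ c → f c ℤ.≤ g c) → ∑ f ℤ.≤ ∑ g
  ∑-mono f≤g = ℤ.+-mono-≤ (sum-mono (f≤g ∘ inj₁)) (sum-mono (f≤g ∘ inj₂))

  ∑-zero : ∑ {m} {n} (λ _ → 0ℤ) ≡ 0ℤ
  ∑-zero = cong₂ _+_ (sum-zero m) (sum-zero n)

  ∑-nonneg : {f : Vertex m n → ℤ} → NonNegative f → 0ℤ ℤ.≤ ∑ f
  ∑-nonneg 0≤f = ℤ.≤-trans (ℤ.≤-reflexive (sym ∑-zero)) (∑-mono 0≤f)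

  ∑-+ : (f g : Vertex m n → ℤ) → ∑ (λ c → f c + g c) ≡ ∑ f + ∑ g
  ∑-+ f g = trans (cong₂ _+_ (Sum.∑-distrib-+ (f ∘ inj₁) (g ∘ inj₁))
                             (Sum.∑-distrib-+ (f ∘ inj₂) (g ∘ inj₂)))
                  (eq (sum (f ∘ inj₁)) (sum (g ∘ inj₁)) (sum (f ∘ inj₂)) (sum (g ∘ inj₂)))
    where
    eq : ∀ a b c d → (a + b) + (c + d) ≡ (a + c) + (b + d)
    eq = solve-∀

  ∑-*ˡ : ∀ x (f : Vertex m n → ℤ) → ∑ (λ c → x * f c) ≡ x * ∑ f
  ∑-*ˡ x f = trans (cong₂ _+_ (sym (Sum.*-distribˡ-sum x (f ∘ inj₁)))
                              (sym (Sum.*-distribˡ-sum x (f ∘ inj₂))))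
                   (sym (ℤ.*-distribˡ-+ x (sum (f ∘ inj₁)) (sum (f ∘ inj₂))))

  ∑-neg : (f : Vertex m n → ℤ) → ∑ (λ c → - f c) ≡ - ∑ f
  ∑-neg f = trans (∑-cong (λ c → sym (ℤ.-1*i≡-i (f c))))
                  (trans (∑-*ˡ -1ℤ f) (ℤ.-1*i≡-i (∑ f)))

  ∑-- : (f g : Vertex m n → ℤ) → ∑ (λ c → f c - g c) ≡ ∑ f - ∑ g
  ∑-- f g = trans (∑-+ f (λ c → - g c)) (cong (_+_ (∑ f)) (∑-neg g))

  ∑-const : ∀ x → ∑ {m} {n} (λ _ → x) ≡ + m * x + + n * x
  ∑-const x = cong₂ _+_ (sum-const m x) (sum-const n x)

  ∑-δ : ∀ (f : Vertex m n → ℤ) c → ∑ (λ c′ → f c′ * indicator (does (c′ ≟ c))) ≡ f c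
  ∑-δ f (inj₁ i) = trans
    (cong₂ _+_ (sum-δ (f ∘ inj₁) i)
               (trans (sum-cong-≗ (λ j → ℤ.*-zeroʳ (f (inj₂ j)))) (sum-zero n)))
    (ℤ.+-identityʳ (f (inj₁ i)))
  ∑-δ f (inj₂ j) = trans
    (cong₂ _+_ (trans (sum-cong-≗ (λ i → ℤ.*-zeroʳ (f (inj₁ i)))) (sum-zero m))
               (sum-δ (f ∘ inj₂) j))
    (ℤ.+-identityˡ (f (inj₂ j)))

indicator-nonneg : ∀ b → 0ℤ ℤ.≤ indicator b
indicator-nonneg false = ℤ.≤-refl
indicator-nonneg true  = ℤ.+≤+ ℕ.z≤n

indicator≤1 : ∀ b → indicator b ℤ.≤ 1ℤ
indicator≤1 false = ℤ.+≤+ ℕ.z≤n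
indicator≤1 true  = ℤ.≤-refl

indicator-*-mono : ∀ b {x y} → x ℤ.≤ y → indicator b * x ℤ.≤ indicator b * y
indicator-*-mono true  x≤y = ℤ.*-monoˡ-≤-nonNeg 1ℤ x≤y
indicator-*-mono false x≤y = ℤ.*-monoˡ-≤-nonNeg 0ℤ x≤y

indicator-mono : ∀ {P Q : Set} (P? : Dec P) (Q? : Dec Q) → (P → Q) →
                 indicator (does P?) ℤ.≤ indicator (does Q?)
indicator-mono (no _)  Q?      _ = indicator-nonneg (does Q?)
indicator-mono (yes _) (yes _) _ = ℤ.≤-refl
indicator-mono (yes p) (no ¬q) f = contradiction (f p) ¬q

module _ {m n : ℕ} where

  term≤∑ : {f : Vertex m n → ℤ} → NonNegative f → ∀ c → f c ℤ.≤ ∑ f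
  term≤∑ {f} 0≤f c = ℤ.≤-trans (ℤ.≤-reflexive (sym (∑-δ f c))) (∑-mono λ c′ →
      term (f c′) (0≤f c′) (does (c′ ≟ c)))
    where
    term : ∀ x → 0ℤ ℤ.≤ x → ∀ b → x * indicator b ℤ.≤ x
    term x 0≤x true  = ℤ.≤-reflexive (ℤ.*-identityʳ x)
    term x 0≤x false = ℤ.≤-trans (ℤ.≤-reflexive (ℤ.*-zeroʳ x)) 0≤x

∑-swap : ∀ {m n k l} (F : Vertex m n → Vertex k l → ℤ) →
         ∑ (λ c → ∑ (λ c′ → F c c′)) ≡ ∑ (λ c′ → ∑ (λ c → F c c′))
∑-swap {m} {n} {k} {l} F = begin
  sum (λ i → sum (F₁₁ i) + sum (F₁₂ i)) + sum (λ j → sum (F₂₁ j) + sum (F₂₂ j))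
    ≡⟨ cong₂ _+_ (Sum.∑-distrib-+ (sum ∘ F₁₁) (sum ∘ F₁₂)) (Sum.∑-distrib-+ (sum ∘ F₂₁) (sum ∘ F₂₂)) ⟩
  (sum (sum ∘ F₁₁) + sum (sum ∘ F₁₂)) + (sum (sum ∘ F₂₁) + sum (sum ∘ F₂₂))
    ≡⟨ cong₂ _+_ (cong₂ _+_ (Sum.∑-comm F₁₁) (Sum.∑-comm F₁₂))
                 (cong₂ _+_ (Sum.∑-comm F₂₁) (Sum.∑-comm F₂₂)) ⟩
  (G₁₁ + G₁₂) + (G₂₁ + G₂₂)
    ≡⟨ eq G₁₁ G₁₂ G₂₁ G₂₂ ⟩
  (G₁₁ + G₂₁) + (G₁₂ + G₂₂)
    ≡⟨ cong₂ _+_ (Sum.∑-distrib-+ (λ i → sum (λ j → F₁₁ j i)) _)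
                 (Sum.∑-distrib-+ (λ i → sum (λ j → F₁₂ j i)) _) ⟨
  _ ∎
  where
  open ≡-Reasoning
  F₁₁ = λ i j → F (inj₁ i) (inj₁ j)
  F₁₂ = λ i j → F (inj₁ i) (inj₂ j)
  F₂₁ = λ i j → F (inj₂ i) (inj₁ j)
  F₂₂ = λ i j → F (inj₂ i) (inj₂ j)
  G₁₁ = sum (λ j → sum (λ i → F₁₁ i j))
  G₁₂ = sum (λ j → sum (λ i → F₁₂ i j))
  G₂₁ = sum (λ j → sum (λ i → F₂₁ i j))
  G₂₂ = sum (λ j → sum (λ i → F₂₂ i j))
  eq : ∀ a b c d → (a + b) + (c + d) ≡ (a + c) + (b + d)
  eq = solve-∀

-- The Laplacian

≤-from-difference : ∀ {x y x′ y′} → x ℤ.≤ y → y - x ≡ y′ - x′ → x′ ℤ.≤ y′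
≤-from-difference x≤y eq = ℤ.0≤i-j⇒j≤i (subst (0ℤ ℤ.≤_) eq (ℤ.i≤j⇒0≤j-i x≤y))

<⇒1+≤ : ∀ {x y} → x ℤ.< y → 1ℤ + x ℤ.≤ y
<⇒1+≤ = ℤ.i<j⇒suc[i]≤j

1+≤⇒< : ∀ {x y} → 1ℤ + x ℤ.≤ y → x ℤ.< y
1+≤⇒< = ℤ.suc[i]≤j⇒i<j

<⇒-<0 : ∀ {x y} → x ℤ.< y → x - y ℤ.< 0ℤ
<⇒-<0 {x} {y} x<y = 1+≤⇒< (≤-from-difference (<⇒1+≤ x<y) (eq x y))
  where
  eq : ∀ x y → y - (1ℤ + x) ≡ 0ℤ - (1ℤ + (x - y))
  eq = solve-∀

module _ {A : Set} {_≲_ : A → A → Set}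
  (total : ∀ x y → x ≲ y ⊎ y ≲ x) (transitive : ∀ {x y z} → x ≲ y → y ≲ z → x ≲ z) where

  maximum : ∀ x xs → ∃ λ y → All (_≲ y) (x ∷ xs)
  maximum x []       = x , [ (λ p → p) , (λ p → p) ] (total x x) ∷ []
  maximum x (z ∷ xs) with maximum x xs
  ... | y , x≲y ∷ xs≲y with total z y
  ...   | inj₁ z≲y = y , x≲y ∷ z≲y ∷ xs≲y
  ...   | inj₂ y≲z = z , transitive x≲y y≲z ∷ [ (λ p → p) , (λ p → p) ] (total z z)
                       ∷ All.map (λ w≲y → transitive w≲y y≲z) xs≲y

module _ {m n : ℕ} where

  vertices : List (Vertex m n)
  vertices = List.map inj₁ (List.allFin m) List.++ List.map inj₂ (List.allFin n)

  ∈-vertices : ∀ c → c ∈ vertices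
  ∈-vertices (inj₁ i) = ∈-++⁺ˡ (∈-map⁺ inj₁ (∈-allFin i))
  ∈-vertices (inj₂ j) = ∈-++⁺ʳ (List.map inj₁ (List.allFin m)) (∈-map⁺ inj₂ (∈-allFin j))

  adj : Vertex m n → Vertex m n → ℤ
  adj c c′ = indicator (adjacent c c′)

  adj-sym : ∀ c c′ → adj c c′ ≡ adj c′ c
  adj-sym (inj₁ _) (inj₁ _) = refl
  adj-sym (inj₁ _) (inj₂ _) = refl
  adj-sym (inj₂ _) (inj₁ _) = refl
  adj-sym (inj₂ _) (inj₂ _) = refl

  -- The Laplacian as a sum of differences along edges: at a maximum of `k` every term is
  -- non-negative, and constants vanish term by term.
  L : (Vertex m n → ℤ) → Config m n
  L k c = ∑ (λ c′ → adj c c′ * (k c - k c′))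

  ∑-Δ : ∀ k c′ → ∑ (λ c → k c * Δ c c′) ≡ L k c′
  ∑-Δ k c′ = begin
    ∑ (λ c → k c * Δ c c′)
      ≡⟨ ∑-cong (λ c → eq₁ (k c) (valency c) (indicator (does (c ≟ c′))) (adj c c′)) ⟩
    ∑ (λ c → k c * valency c * indicator (does (c ≟ c′)) - k c * adj c c′)
      ≡⟨ ∑-- (λ c → k c * valency c * indicator (does (c ≟ c′))) (λ c → k c * adj c c′) ⟩
    ∑ (λ c → k c * valency c * indicator (does (c ≟ c′))) - ∑ (λ c → k c * adj c c′)
      ≡⟨ cong (_- ∑ (λ c → k c * adj c c′)) (∑-δ (λ c → k c * valency c) c′) ⟩
    k c′ * valency c′ - ∑ (λ c → k c * adj c c′)
      ≡⟨ cong (_- ∑ (λ c → k c * adj c c′)) (∑-*ˡ (k c′) (adj c′)) ⟨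
    ∑ (λ c → k c′ * adj c′ c) - ∑ (λ c → k c * adj c c′)
      ≡⟨ ∑-- (λ c → k c′ * adj c′ c) (λ c → k c * adj c c′) ⟨
    ∑ (λ c → k c′ * adj c′ c - k c * adj c c′)
      ≡⟨ ∑-cong (λ c → trans (cong (λ a → k c′ * adj c′ c - k c * a) (adj-sym c c′))
                             (eq₂ (k c′) (k c) (adj c′ c))) ⟩
    L k c′ ∎
    where
    open ≡-Reasoning
    eq₁ : ∀ x v i a → x * (v * i - a) ≡ x * v * i - x * a
    eq₁ = solve-∀
    eq₂ : ∀ x y a → x * a - y * a ≡ a * (x - y)
    eq₂ = solve-∀

  L-cong : ∀ {k l} → k ≗ l → ∀ c → L k c ≡ L l c
  L-cong k≗l c = ∑-cong (λ c′ → cong₂ (λ x y → adj c c′ * (x - y)) (k≗l c) (k≗l c′))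

  L-+ : ∀ k l c → L (λ c → k c + l c) c ≡ L k c + L l c
  L-+ k l c = trans (∑-cong (λ c′ → eq (adj c c′) (k c) (l c) (k c′) (l c′)))
                    (∑-+ (λ c′ → adj c c′ * (k c - k c′)) (λ c′ → adj c c′ * (l c - l c′)))
    where
    eq : ∀ a x y x′ y′ → a * ((x + y) - (x′ + y′)) ≡ a * (x - x′) + a * (y - y′)
    eq = solve-∀

  L-*ˡ : ∀ x k c → L (λ c → x * k c) c ≡ x * L k c
  L-*ˡ x k c = trans (∑-cong (λ c′ → eq (adj c c′) x (k c) (k c′)))
                     (∑-*ˡ x (λ c′ → adj c c′ * (k c - k c′)))
    where
    eq : ∀ a x y y′ → a * (x * y - x * y′) ≡ x * (a * (y - y′))
    eq = solve-∀

  -- Symmetry of the adjacency after exchanging the two sums. With `h` constant it gives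
  -- conservation of degree, with `height` the termination of firing.
  L-self-adjoint : ∀ h k → ∑ (λ c → h c * L k c) ≡ ∑ (λ c → k c * L h c)
  L-self-adjoint h k = begin
    ∑ (λ c → h c * L k c)
      ≡⟨ ∑-cong (λ c → expand h k c) ⟩
    ∑ (λ c → ∑ (λ c′ → adj c c′ * (h c * k c)) - ∑ (λ c′ → adj c c′ * (h c * k c′)))
      ≡⟨ ∑-- A (λ c → ∑ (λ c′ → adj c c′ * (h c * k c′))) ⟩
    ∑ A - ∑ (λ c → ∑ (λ c′ → adj c c′ * (h c * k c′)))
      ≡⟨ cong (_-_ (∑ A)) (∑-swap (λ c c′ → adj c c′ * (h c * k c′))) ⟩
    ∑ A - ∑ (λ c′ → ∑ (λ c → adj c c′ * (h c * k c′)))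
      ≡⟨ cong₂ _-_ (∑-cong (λ c → ∑-cong (λ c′ → cong (adj c c′ *_) (ℤ.*-comm (h c) (k c)))))
                   (∑-cong (λ c → ∑-cong (λ c′ →
                     cong₂ _*_ (adj-sym c′ c) (ℤ.*-comm (h c′) (k c))))) ⟩
    ∑ B - ∑ (λ c → ∑ (λ c′ → adj c c′ * (k c * h c′)))
      ≡⟨ ∑-- B (λ c → ∑ (λ c′ → adj c c′ * (k c * h c′))) ⟨
    ∑ (λ c → ∑ (λ c′ → adj c c′ * (k c * h c)) - ∑ (λ c′ → adj c c′ * (k c * h c′)))
      ≡⟨ ∑-cong (λ c → expand k h c) ⟨
    ∑ (λ c → k c * L h c) ∎
    where
    open ≡-Reasoning
    A = λ c → ∑ (λ c′ → adj c c′ * (h c * k c))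
    B = λ c → ∑ (λ c′ → adj c c′ * (k c * h c))
    eq : ∀ a x y z → x * (a * (y - z)) ≡ a * (x * y) - a * (x * z)
    eq = solve-∀
    expand : ∀ h k c → h c * L k c ≡
      ∑ (λ c′ → adj c c′ * (h c * k c)) - ∑ (λ c′ → adj c c′ * (h c * k c′))
    expand h k c = trans (sym (∑-*ˡ (h c) (λ c′ → adj c c′ * (k c - k c′))))
      (trans (∑-cong (λ c′ → eq (adj c c′) (h c) (k c) (k c′)))
             (∑-- (λ c′ → adj c c′ * (h c * k c)) (λ c′ → adj c c′ * (h c * k c′))))

  L-const : ∀ x c → L (λ _ → x) c ≡ 0ℤ
  L-const x c = trans (∑-cong (λ c′ → eq (adj c c′) x)) (∑-zero {m} {n})
    where
    eq : ∀ a x → a * (x - x) ≡ 0ℤ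
    eq = solve-∀

  degree-L : ∀ k → degree (L k) ≡ 0ℤ
  degree-L k = begin
    ∑ (L k)                  ≡⟨ ∑-cong (λ c → ℤ.*-identityˡ (L k c)) ⟨
    ∑ (λ c → 1ℤ * L k c)     ≡⟨ L-self-adjoint (λ _ → 1ℤ) k ⟩
    ∑ (λ c → k c * L (λ _ → 1ℤ) c)
      ≡⟨ ∑-cong (λ c → trans (cong (k c *_) (L-const 1ℤ c)) (ℤ.*-zeroʳ (k c))) ⟩
    ∑ {m} {n} (λ _ → 0ℤ)     ≡⟨ ∑-zero {m} {n} ⟩
    0ℤ ∎
    where open ≡-Reasoning

  -- Toppling equivalence in the form u - v = L k; being a record, it
  -- determines u and v, unlike the function _∼_.
  record _≃_ (u v : Config m n) : Set where
    constructor topple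
    field
      firing   : Vertex m n → ℤ
      equation : ∀ c → u c - v c ≡ L firing c
  open _≃_ public

  ≃⇒∼ : ∀ {u v} → u ≃ v → u ∼ v
  ≃⇒∼ (topple k eq) = k , λ c → trans (eq c) (sym (∑-Δ k c))

  ∼⇒≃ : ∀ {u v} → u ∼ v → u ≃ v
  ∼⇒≃ (k , eq) = topple k λ c → trans (eq c) (∑-Δ k c)

  ≃-shift : ∀ {u v u′ v′} → (∀ c → u c - v c ≡ u′ c - v′ c) → u ≃ v → u′ ≃ v′
  ≃-shift eq (topple k p) = topple k λ c → trans (sym (eq c)) (p c)

  ≗⇒≃ : ∀ {u v} → u ≗ v → u ≃ v
  ≗⇒≃ u≗v = topple (λ _ → 0ℤ) λ c →
    trans (ℤ.i≡j⇒i-j≡0 (u≗v c)) (sym (L-const 0ℤ c))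

  ≃-refl : ∀ {u} → u ≃ u
  ≃-refl = ≗⇒≃ (λ _ → refl)

  ≃-sym : ∀ {u v} → u ≃ v → v ≃ u
  ≃-sym {u} {v} (topple k eq) = topple (λ c → -1ℤ * k c) λ c →
    trans (neg (u c) (v c)) (trans (cong (-1ℤ *_) (eq c)) (sym (L-*ˡ -1ℤ k c)))
    where
    neg : ∀ x y → y - x ≡ -1ℤ * (x - y)
    neg = solve-∀

  ≃-trans : ∀ {u v w} → u ≃ v → v ≃ w → u ≃ w
  ≃-trans {u} {v} {w} (topple k p) (topple l q) = topple (λ c → k c + l c) λ c →
    trans (split (u c) (v c) (w c)) (trans (cong₂ _+_ (p c) (q c)) (sym (L-+ k l c)))
    where
    split : ∀ x y z → x - z ≡ (x - y) + (y - z)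
    split = solve-∀

  degree-≃ : ∀ {u v} → u ≃ v → degree u ≡ degree v
  degree-≃ {u} {v} (topple k eq) = ℤ.i-j≡0⇒i≡j (degree u) (degree v)
    (trans (sym (∑-- u v)) (trans (∑-cong eq) (degree-L k)))

  effective : ∀ {u w} → NonNegative w → u ≃ w → Effective u
  effective {w = w} 0≤w u≃w = w , 0≤w , ≃⇒∼ u≃w

  effective⁻¹ : ∀ u → Effective u → ∃ λ w → NonNegative w × u ≃ w
  effective⁻¹ u (w , 0≤w , u∼w) = w , 0≤w , ∼⇒≃ u∼w

  Effective-resp-≃ : ∀ {u v} → u ≃ v → Effective u → Effective v
  Effective-resp-≃ u≃v (w , 0≤w , u∼w) = effective 0≤w (≃-trans (≃-sym u≃v) (∼⇒≃ u∼w))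

  Order : Set
  Order = Vertex m n → ℤ

  before : Order → Vertex m n → Vertex m n → ℤ
  before ord c′ c = indicator (does (ord c′ ℤ.<? ord c))

  -- For an injective order, the indegree in the acyclic orientation that directs each edge from its
  -- earlier to its later end.
  indegree : Order → Vertex m n → ℤ
  indegree ord c = ∑ (λ c′ → adj c c′ * before ord c′ c)

  -- The witness is the first vertex, in the order, among those where k is
  -- maximal: each of its earlier neighbours contributes at least 1 to L k.
  first-maximum : Vertex m n → ∀ (ord : Order) k →
    ∃ λ c → (∀ c′ → k c′ ℤ.≤ k c) × indegree ord c ℤ.≤ L k c
  first-maximum c₀ ord k with maximum {_≲_ = _≲_} total transitive c₀ vertices
    where
    _≲_ : Vertex m n → Vertex m n → Set
    c ≲ c′ = k c ℤ.< k c′ ⊎ (k c ≡ k c′ × ord c′ ℤ.≤ ord c)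
    total : ∀ c c′ → c ≲ c′ ⊎ c′ ≲ c
    total c c′ with ℤ.<-cmp (k c) (k c′) | ℤ.≤-total (ord c′) (ord c)
    ... | tri< k< _ _ | _      = inj₁ (inj₁ k<)
    ... | tri> _ _ k> | _      = inj₂ (inj₁ k>)
    ... | tri≈ _ k≡ _ | inj₁ p = inj₁ (inj₂ (k≡ , p))
    ... | tri≈ _ k≡ _ | inj₂ p = inj₂ (inj₂ (sym k≡ , p))
    transitive : ∀ {c c′ c″} → c ≲ c′ → c′ ≲ c″ → c ≲ c″
    transitive (inj₁ p)       (inj₁ q)       = inj₁ (ℤ.<-trans p q)
    transitive (inj₁ p)       (inj₂ (q , _)) = inj₁ (ℤ.<-≤-trans p (ℤ.≤-reflexive q))
    transitive (inj₂ (p , _)) (inj₁ q)       = inj₁ (ℤ.≤-<-trans (ℤ.≤-reflexive p) q)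
    transitive (inj₂ (p , r)) (inj₂ (q , s)) = inj₂ (trans p q , ℤ.≤-trans s r)
  ... | c , _ ∷ all = c , k≤ , ∑-mono λ c′ → indicator-*-mono (adjacent c c′) (term c′)
    where
    k≤ : ∀ c′ → k c′ ℤ.≤ k c
    k≤ c′ with All.lookup all (∈-vertices c′)
    ... | inj₁ k<       = ℤ.<⇒≤ k<
    ... | inj₂ (k≡ , _) = ℤ.≤-reflexive k≡
    term : ∀ c′ → before ord c′ c ℤ.≤ k c - k c′
    term c′ with ord c′ ℤ.<? ord c
    ... | no  _ = ℤ.i≤j⇒0≤j-i (k≤ c′)
    ... | yes o< with All.lookup all (∈-vertices c′)
    ...   | inj₁ k<        = ≤-from-difference (<⇒1+≤ k<) (eq (k c) (k c′))
      where
      eq : ∀ x y → x - (1ℤ + y) ≡ (x - y) - 1ℤ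
      eq = solve-∀
    ...   | inj₂ (_ , o≥) = contradiction o< (ℤ.≤⇒≯ o≥)

-- Orders and parking configurations

module _ {m n : ℕ} where

  any-vertex? : {P : Vertex m n → Set} → (∀ c → Dec (P c)) → Dec (∃ P)
  any-vertex? P? with Fin.any? (P? ∘ inj₁) | Fin.any? (P? ∘ inj₂)
  ... | yes (i , p) | _           = yes (inj₁ i , p)
  ... | no _        | yes (j , p) = yes (inj₂ j , p)
  ... | no ¬p       | no ¬q       = no λ { (inj₁ i , p) → ¬p (i , p) ; (inj₂ j , q) → ¬q (j , q) }

  all-vertices? : {P : Vertex m n → Set} → (∀ c → Dec (P c)) → Dec (∀ c → P c)
  all-vertices? P? with Fin.all? (P? ∘ inj₁) | Fin.all? (P? ∘ inj₂)
  ... | yes p | yes q = yes [ p , q ]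
  ... | no ¬p | _     = no λ p → ¬p (p ∘ inj₁)
  ... | _     | no ¬q = no λ q → ¬q (q ∘ inj₂)

  isSink? : (c : Vertex m n) → Dec (IsSink c)
  isSink? (inj₁ i) with ℕ.suc (toℕ i) ℕ.≟ m
  ... | yes eq = yes (last eq)
  ... | no neq = no λ { (last eq) → neq eq }
  isSink? (inj₂ j) = no λ ()

  sink-unique : {c c′ : Vertex m n} → IsSink c → IsSink c′ → c ≡ c′
  sink-unique (last p) (last q) = cong inj₁ (Fin.toℕ-injective (ℕ.suc-injective (trans p (sym q))))

  valency-A : ∀ i → valency {m} {n} (inj₁ i) ≡ + n
  valency-A i = trans (cong₂ _+_ (sum-zero m) (sum-const n 1ℤ)) (eq (+ n))
    where
    eq : ∀ x → 0ℤ + x * 1ℤ ≡ x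
    eq = solve-∀

  valency-B : ∀ j → valency {m} {n} (inj₂ j) ≡ + m
  valency-B j = trans (cong₂ _+_ (sum-const m 1ℤ) (sum-zero n)) (eq (+ m))
    where
    eq : ∀ x → x * 1ℤ + 0ℤ ≡ x
    eq = solve-∀

  Injective : Order {m} {n} → Set
  Injective ord = ∀ {c c′} → ord c ≡ ord c′ → c ≡ c′

  reverse : Order {m} {n} → Order {m} {n}
  reverse ord c = - ord c

  before-reverse : ∀ ord c c′ → before (reverse ord) c c′ ≡ before ord c′ c
  before-reverse ord c c′ = ℤ.≤-antisym
    (indicator-mono (reverse ord c ℤ.<? reverse ord c′) (ord c′ ℤ.<? ord c) ℤ.neg-cancel-<)
    (indicator-mono (ord c′ ℤ.<? ord c) (reverse ord c ℤ.<? reverse ord c′) ℤ.neg-mono-<)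

  before-total : ∀ (ord : Order {m} {n}) c c′ → ord c ≢ ord c′ → before ord c c′ + before ord c′ c ≡ 1ℤ
  before-total ord c c′ neq with ord c ℤ.<? ord c′ | ord c′ ℤ.<? ord c
  ... | yes p | yes q = contradiction p (ℤ.<-asym q)
  ... | yes _ | no _  = refl
  ... | no _  | yes _ = refl
  ... | no ¬p | no ¬q = contradiction (ℤ.≤-antisym (ℤ.≮⇒≥ ¬q) (ℤ.≮⇒≥ ¬p)) neq

  adjacent-irreflexive : ∀ c → adjacent {m} {n} c c ≡ false
  adjacent-irreflexive (inj₁ _) = refl
  adjacent-irreflexive (inj₂ _) = refl

  ν : Order {m} {n} → Config m n
  ν ord c = indegree ord c - 1ℤ

  κ : Config m n
  κ c = valency c - + 2

  -- Each neighbour precedes `c` in exactly one of the two orders, so the indegrees add up to the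
  -- valency; the two subtracted units make the 2 in `κ`.
  ν-reverse : ∀ {ord} → Injective ord → ∀ c → ν (reverse ord) c + ν ord c ≡ κ c
  ν-reverse {ord} inj c = begin
    ν (reverse ord) c + ν ord c
      ≡⟨ eq (indegree (reverse ord) c) (indegree ord c) ⟩
    indegree (reverse ord) c + indegree ord c - + 2
      ≡⟨ cong (_- + 2) (∑-+ (λ c′ → adj c c′ * before (reverse ord) c′ c)
                            (λ c′ → adj c c′ * before ord c′ c)) ⟨
    ∑ (λ c′ → adj c c′ * before (reverse ord) c′ c + adj c c′ * before ord c′ c) - + 2
      ≡⟨ cong (_- + 2) (∑-cong λ c′ → trans (sym (ℤ.*-distribˡ-+ (adj c c′) (before (reverse ord) c′ c) (before ord c′ c))) (term c′)) ⟩
    κ c ∎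
    where
    open ≡-Reasoning
    eq : ∀ x y → (x - 1ℤ) + (y - 1ℤ) ≡ x + y - + 2
    eq = solve-∀
    term : ∀ c′ → adj c c′ * (before (reverse ord) c′ c + before ord c′ c) ≡ adj c c′
    term c′ with c ≟ c′
    -- A vertex precedes itself in neither order, so here the equation rests on the absence of
    -- loops.
    ... | yes refl rewrite adjacent-irreflexive c = ℤ.*-zeroˡ (before (reverse ord) c c + before ord c c)
    ... | no c≢c′ = trans
      (cong (λ x → adj c c′ * (x + before ord c′ c)) (before-reverse ord c′ c))
      (trans (cong (adj c c′ *_) (before-total ord c c′ (c≢c′ ∘ inj))) (ℤ.*-identityʳ (adj c c′)))

  degree-κ : degree κ ≡ + 2 * (+ m * + n - + m - + n)
  degree-κ = begin
    ∑ κ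
      ≡⟨ ∑-- (valency {m} {n}) (λ _ → + 2) ⟩
    ∑ (valency {m} {n}) - ∑ {m} {n} (λ _ → + 2)
      ≡⟨ cong₂ _-_ (cong₂ _+_ (trans (sum-cong-≗ valency-A) (sum-const m (+ n)))
                              (trans (sum-cong-≗ valency-B) (sum-const n (+ m))))
                   (∑-const {m} {n} (+ 2)) ⟩
    (+ m * + n + + n * + m) - (+ m * + 2 + + n * + 2)
      ≡⟨ eq (+ m) (+ n) ⟩
    + 2 * (+ m * + n - + m - + n) ∎
    where
    open ≡-Reasoning
    eq : ∀ x y → (x * y + y * x) - (x * + 2 + y * + 2) ≡ + 2 * (x * y - x - y)
    eq = solve-∀

  degree-ν-reverse : ∀ ord → degree (ν (reverse ord)) ≡ degree (ν ord)
  degree-ν-reverse ord = begin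
    degree (ν (reverse ord))
      ≡⟨ ∑-- (indegree (reverse ord)) (λ _ → 1ℤ) ⟩
    ∑ (indegree (reverse ord)) - ∑ {m} {n} (λ _ → 1ℤ)
      ≡⟨ cong (_- ∑ {m} {n} (λ _ → 1ℤ)) (∑-swap (λ c c′ → adj c c′ * before (reverse ord) c′ c)) ⟩
    ∑ (λ c′ → ∑ (λ c → adj c c′ * before (reverse ord) c′ c)) - ∑ {m} {n} (λ _ → 1ℤ)
      ≡⟨ cong (_- ∑ {m} {n} (λ _ → 1ℤ)) (∑-cong λ c′ → ∑-cong λ c →
           cong₂ _*_ (adj-sym c c′) (before-reverse ord c′ c)) ⟩
    ∑ (indegree ord) - ∑ {m} {n} (λ _ → 1ℤ)
      ≡⟨ ∑-- (indegree ord) (λ _ → 1ℤ) ⟨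
    degree (ν ord) ∎
    where open ≡-Reasoning

  -- Both orientations have one incoming end per edge, so the two degrees agree, and their sum is
  -- the degree of `κ`.
  degree-ν : ∀ {ord} → Injective ord → degree (ν ord) ≡ + m * + n - + m - + n
  degree-ν {ord} inj = ℤ.*-cancelˡ-≡ (+ 2) _ _ (begin
    + 2 * degree (ν ord)
      ≡⟨ eq (degree (ν ord)) ⟩
    degree (ν ord) + degree (ν ord)
      ≡⟨ cong (_+ degree (ν ord)) (degree-ν-reverse ord) ⟨
    degree (ν (reverse ord)) + degree (ν ord)
      ≡⟨ ∑-+ (ν (reverse ord)) (ν ord) ⟨
    ∑ (λ c → ν (reverse ord) c + ν ord c)
      ≡⟨ ∑-cong (ν-reverse inj) ⟩
    degree κ
      ≡⟨ degree-κ ⟩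
    + 2 * (+ m * + n - + m - + n) ∎)
    where
    open ≡-Reasoning
    eq : ∀ x → + 2 * x ≡ x + x
    eq = solve-∀

  -- If `ν ord` minus `w` is `L k`, then at the first maximum of `k` this is at least the indegree,
  -- which forces `w` to be at most -1 there.
  ν-not-effective : Vertex m n → ∀ ord → ¬ Effective (ν ord)
  ν-not-effective c₀ ord eff =
    let w , 0≤w , topple k eq = effective⁻¹ (ν ord) eff
        c , _ , in≤L = first-maximum c₀ ord k
    in  impossible (0≤w c) (ℤ.≤-trans in≤L (ℤ.≤-reflexive (sym (eq c))))
    where
    diff : ∀ i w → (i - 1ℤ - w) - i ≡ -1ℤ - w
    diff = solve-∀
    impossible : ∀ {i w} → 0ℤ ℤ.≤ w → ¬ (i ℤ.≤ i - 1ℤ - w)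
    impossible {i} {w} 0≤w i≤ with ℤ.≤-trans 0≤w (≤-from-difference {y′ = -1ℤ} i≤ (diff i w))
    ... | ()

  NonNegativeOffSink : Config m n → Set
  NonNegativeOffSink u = ∀ c → ¬ IsSink c → 0ℤ ℤ.≤ u c

  -- A complete run of the fire: a non-sink vertex burns once its burnt neighbours outnumber its
  -- grains.
  record Burnable (u : Config m n) : Set where
    constructor burnable
    field
      order     : Order {m} {n}
      injective : Injective order
      burns     : ∀ c → ¬ IsSink c → u c ℤ.< indegree order c

  -- A positive witness against parking. Only members of the set are tested, because firing it never
  -- lowers a value outside (`Δ-set-outside`).
  record LegalSet (u : Config m n) : Set where
    constructor legalSet
    field
      set      : Vertex m n → Bool
      nonempty : ∃ λ c → set c ≡ true
      sinkless : ∀ c → set c ≡ true → ¬ IsSink c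
      legal    : ∀ c → set c ≡ true → Δ-set set c ℤ.≤ u c

  Δ-set-≡ : ∀ (C : Vertex m n → Bool) c → Δ-set C c ≡ L (indicator ∘ C) c
  Δ-set-≡ C = ∑-Δ (indicator ∘ C)

  -- The first vertex of `C` to burn has too few grains: its earlier neighbours all lie outside `C`,
  -- and firing `C` sends a grain to each of them. Here it arises as the first maximum of the
  -- indicator of `C`.
  burnable⇒illegal : ∀ {u} → Burnable u → (C : Vertex m n → Bool) → (∃ λ c → C c ≡ true) →
    (∀ c → C c ≡ true → ¬ IsSink c) → ∃ λ c → ¬ IsSink c × u c ℤ.< Δ-set C c
  burnable⇒illegal {u} (burnable ord _ burns) C (c₀ , c₀∈C) sinkless
    with first-maximum c₀ ord (indicator ∘ C)
  ... | c , maximal , in≤L = c , c≢sink ,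
        ℤ.<-≤-trans (burns c c≢sink) (ℤ.≤-trans in≤L (ℤ.≤-reflexive (sym (Δ-set-≡ C c))))
    where
    c∈C : ∀ b → indicator (C c₀) ℤ.≤ indicator b → b ≡ true
    c∈C true  _ = refl
    c∈C false p rewrite c₀∈C = contradiction p λ { (ℤ.+≤+ ()) }
    c≢sink = sinkless c (c∈C (C c) (maximal c₀))

  Δ-set-outside : ∀ C c → C c ≡ false → Δ-set {m} {n} C c ℤ.≤ 0ℤ
  Δ-set-outside C c c∉C = ℤ.≤-trans (ℤ.≤-reflexive (Δ-set-≡ C c))
    (ℤ.≤-trans (∑-mono (λ c′ → ℤ.≤-trans (indicator-*-mono (adjacent c c′) (term c′))
                                        (ℤ.≤-reflexive (ℤ.*-zeroʳ (adj c c′)))))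
               (ℤ.≤-reflexive (∑-zero {m} {n})))
    where
    term : ∀ c′ → indicator (C c) - indicator (C c′) ℤ.≤ 0ℤ
    term c′ rewrite c∉C = ℤ.i≤j⇒i-j≤0 (indicator-nonneg (C c′))

  burnable⇒parking : ∀ {u} → NonNegativeOffSink u → Burnable u → Parking u
  burnable⇒parking {u} 0≤u b = 0≤u , λ C nonempty sinkless →
    let c , c≢sink , u<Δ = burnable⇒illegal b C nonempty sinkless
    in  c , c≢sink , <⇒-<0 u<Δ

  parking⇒illegal : ∀ {u} → Parking u → ¬ LegalSet u
  parking⇒illegal {u} (0≤u , p) (legalSet C nonempty sinkless legal) with p C nonempty sinkless
  ... | c , c≢sink , neg = ℤ.<⇒≱ neg (ℤ.i≤j⇒0≤j-i (Δ≤u (C c) refl))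
    where
    Δ≤u : ∀ b → C c ≡ b → Δ-set C c ℤ.≤ u c
    Δ≤u true  c∈C = legal c c∈C
    Δ≤u false c∉C = ℤ.≤-trans (Δ-set-outside C c c∉C) (0≤u c c≢sink)

-- Dhar's burning algorithm

bounded-by-ℕ : ∀ x → ∃ λ t → x ℤ.≤ + t
bounded-by-ℕ (+ t)    = t , ℤ.≤-refl
bounded-by-ℕ -[1+ _ ] = 0 , ℤ.-≤+

-[1+t]<-t : ∀ t → -[1+ t ] ℤ.< - + t
-[1+t]<-t ℕ.zero    = ℤ.-<+
-[1+t]<-t (ℕ.suc t) = ℤ.-<- (ℕ.n<1+n t)

module _ {m n : ℕ} (u : Config m n) where

  Burnt : Order {m} {n} → Vertex m n → Set
  Burnt ord c = ord c ℤ.< 0ℤ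

  burnt? : ∀ ord c → Dec (Burnt ord c)
  burnt? ord c = ord c ℤ.<? 0ℤ

  burntNeighbours : Order {m} {n} → Vertex m n → ℤ
  burntNeighbours ord c = ∑ (λ c′ → adj c c′ * indicator (does (burnt? ord c′)))

  unburnt : Order {m} {n} → Vertex m n → Bool
  unburnt ord c = not (does (burnt? ord c))

  -- The fuel t bounds the number of unburnt vertices; burning times are
  -- counted down, so that they lie below - t and the next one is - t.
  record Burning (t : ℕ) : Set where
    constructor burning
    field
      order     : Order {m} {n}
      settled   : ∀ c → ¬ Burnt order c ⊎ order c ℤ.< - + t
      injective : ∀ {c c′} → Burnt order c → order c ≡ order c′ → c ≡ c′
      burns     : ∀ c → Burnt order c → ¬ IsSink c → u c ℤ.< indegree order c
      sinkBurnt : ∀ c → IsSink c → Burnt order c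
      fuel      : ∑ (indicator ∘ unburnt order) ℤ.≤ + t

  -- Only the sink burns at the start. Unburnt vertices share the time 0, which is why injectivity
  -- is demanded of burnt vertices only.
  ignite : ∃ Burning
  ignite = T , burning ord settled injective burns sinkBurnt fuel
    where
    T = proj₁ (bounded-by-ℕ (∑ {m} {n} (λ _ → 1ℤ)))
    ord : Order
    ord c = if does (isSink? c) then -[1+ T ] else 0ℤ
    settled : ∀ c → ¬ Burnt ord c ⊎ ord c ℤ.< - + T
    settled c with isSink? c
    ... | yes _ = inj₂ (-[1+t]<-t T)
    ... | no  _ = inj₁ λ { (ℤ.+<+ ()) }
    injective : ∀ {c c′} → Burnt ord c → ord c ≡ ord c′ → c ≡ c′
    injective {c} {c′} burnt eq with isSink? c | isSink? c′
    ... | yes s | yes s′ = sink-unique s s′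
    ... | yes _ | no _   = contradiction eq λ ()
    ... | no _  | _      = contradiction burnt λ { (ℤ.+<+ ()) }
    burns : ∀ c → Burnt ord c → ¬ IsSink c → u c ℤ.< indegree ord c
    burns c burnt c≢sink with isSink? c
    ... | yes s = contradiction s c≢sink
    ... | no _  = contradiction burnt λ { (ℤ.+<+ ()) }
    sinkBurnt : ∀ c → IsSink c → Burnt ord c
    sinkBurnt c s with isSink? c
    ... | yes _ = ℤ.-<+
    ... | no ¬s = contradiction s ¬s
    fuel : ∑ (indicator ∘ unburnt ord) ℤ.≤ + T
    fuel = ℤ.≤-trans (∑-mono (λ c → indicator≤1 (unburnt ord c)))
                     (proj₂ (bounded-by-ℕ (∑ {m} {n} (λ _ → 1ℤ))))

  -- The new time `-[1+ t ]` is later than all times in use and still negative. Hence the relation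
  -- "before" persists below old burnt vertices, and at `c₀` it holds for every burnt neighbour.
  burn-one : ∀ {t} (b : Burning (ℕ.suc t)) → let ord = Burning.order b in
             ∀ c → ¬ Burnt ord c → u c ℤ.< burntNeighbours ord c → Burning t
  burn-one {t} (burning ord settled injective burns sinkBurnt fuel) c₀ c₀-unburnt c₀-burns =
    burning ord′ settled′ injective′ burns′ sinkBurnt′ fuel′
    where
    ord′ : Order
    ord′ c = if does (c ≟ c₀) then -[1+ t ] else ord c

    at : ∀ {c} → c ≡ c₀ → ord′ c ≡ -[1+ t ]
    at {c} c≡ with c ≟ c₀
    ... | yes _ = refl
    ... | no c≢ = contradiction c≡ c≢

    off : ∀ {c} → c ≢ c₀ → ord′ c ≡ ord c
    off {c} c≢ with c ≟ c₀
    ... | yes c≡ = contradiction c≡ c≢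
    ... | no _   = refl

    burnt≢c₀ : ∀ {c} → Burnt ord c → c ≢ c₀
    burnt≢c₀ burnt refl = c₀-unburnt burnt

    early : ∀ {c} → Burnt ord c → ord c ℤ.< -[1+ t ]
    early {c} burnt with settled c
    ... | inj₁ ¬burnt = contradiction burnt ¬burnt
    ... | inj₂ lt     = lt

    settled′ : ∀ c → ¬ Burnt ord′ c ⊎ ord′ c ℤ.< - + t
    settled′ c with c ≟ c₀ | settled c
    ... | yes _ | _       = inj₂ (-[1+t]<-t t)
    ... | no _  | inj₁ ¬b = inj₁ ¬b
    ... | no _  | inj₂ lt = inj₂ (ℤ.<-trans lt (-[1+t]<-t t))

    injective′ : ∀ {c c′} → Burnt ord′ c → ord′ c ≡ ord′ c′ → c ≡ c′
    injective′ {c} {c′} burnt eq with c ≟ c₀ | c′ ≟ c₀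
    ... | yes p | yes q = trans p (sym q)
    ... | yes _ | no  _ = contradiction (early (subst (ℤ._< 0ℤ) eq burnt)) (ℤ.<-irrefl (sym eq))
    ... | no  _ | yes _ = contradiction (early burnt) (ℤ.<-irrefl eq)
    ... | no  _ | no  _ = injective burnt eq

    before-c₀ : ∀ c → Burnt ord c → ord′ c ℤ.< ord′ c₀
    before-c₀ c burnt = subst₂ ℤ._<_ (sym (off (burnt≢c₀ burnt))) (sym (at refl)) (early burnt)

    before-mono : ∀ c → Burnt ord c → ∀ c′ → ord c′ ℤ.< ord c → ord′ c′ ℤ.< ord′ c
    before-mono c burnt c′ lt =
      subst₂ ℤ._<_ (sym (off (burnt≢c₀ (ℤ.<-trans lt burnt)))) (sym (off (burnt≢c₀ burnt))) lt

    burns-c₀ : u c₀ ℤ.< indegree ord′ c₀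
    burns-c₀ = ℤ.<-≤-trans c₀-burns (∑-mono λ c′ → indicator-*-mono (adjacent c₀ c′)
      (indicator-mono (burnt? ord c′) (ord′ c′ ℤ.<? ord′ c₀) (before-c₀ c′)))

    burns-old : ∀ c → Burnt ord c → ¬ IsSink c → u c ℤ.< indegree ord′ c
    burns-old c burnt c≢sink = ℤ.<-≤-trans (burns c burnt c≢sink)
      (∑-mono λ c′ → indicator-*-mono (adjacent c c′)
        (indicator-mono (ord c′ ℤ.<? ord c) (ord′ c′ ℤ.<? ord′ c) (before-mono c burnt c′)))

    burns′ : ∀ c → Burnt ord′ c → ¬ IsSink c → u c ℤ.< indegree ord′ c
    burns′ c burnt c≢sink = cases (c ≟ c₀)
      where
      cases : Dec (c ≡ c₀) → u c ℤ.< indegree ord′ c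
      cases (yes refl) = burns-c₀
      cases (no c≢)    = burns-old c (subst (ℤ._< 0ℤ) (off c≢) burnt) c≢sink

    sinkBurnt′ : ∀ c → IsSink c → Burnt ord′ c
    sinkBurnt′ c s with c ≟ c₀
    ... | yes _ = ℤ.-<+
    ... | no _  = sinkBurnt c s

    -- The factor `1ℤ` gives the second summand the shape of `∑-δ`, which sums it to 1, the unit of
    -- fuel spent.
    one-less : ∀ c → indicator (unburnt ord′ c) + 1ℤ * indicator (does (c ≟ c₀))
                   ℤ.≤ indicator (unburnt ord c)
    one-less c with c ≟ c₀
    ... | no _ = ℤ.≤-reflexive (ℤ.+-identityʳ (indicator (unburnt ord c)))
    ... | yes refl with burnt? ord c₀
    ...   | yes burnt = contradiction burnt c₀-unburnt
    ...   | no _      = ℤ.≤-refl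

    fuel′ : ∑ (indicator ∘ unburnt ord′) ℤ.≤ + t
    fuel′ = ≤-from-difference
      (ℤ.≤-trans (∑-mono one-less) fuel)
      (trans (cong (_-_ (+ ℕ.suc t)) (trans (∑-+ (indicator ∘ unburnt ord′) (λ c → 1ℤ * indicator (does (c ≟ c₀))))
                                            (cong (_+_ S) (∑-δ (λ _ → 1ℤ) c₀))))
             (eq (+ t) S))
      where
      S = ∑ (indicator ∘ unburnt ord′)
      eq : ∀ t s → (1ℤ + t) - (s + 1ℤ) ≡ t - s
      eq = solve-∀

  -- Grains exchanged between unburnt vertices cancel, so an unburnt vertex loses exactly one grain
  -- per burnt neighbour.
  Δ-unburnt : ∀ ord c → ¬ Burnt ord c → Δ-set (unburnt ord) c ≡ burntNeighbours ord c
  Δ-unburnt ord c ¬burnt = trans (Δ-set-≡ (unburnt ord) c)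
    (∑-cong λ c′ → cong (adj c c′ *_) (term c′))
    where
    term : ∀ c′ → indicator (unburnt ord c) - indicator (unburnt ord c′)
                ≡ indicator (does (burnt? ord c′))
    term c′ with burnt? ord c | burnt? ord c′
    ... | yes burnt | _     = contradiction burnt ¬burnt
    ... | no _      | yes _ = refl
    ... | no _      | no _  = refl

  unburnt-≡ : ∀ {ord c} → ¬ Burnt ord c → unburnt ord c ≡ true
  unburnt-≡ {ord} {c} ¬burnt with burnt? ord c
  ... | yes burnt = contradiction burnt ¬burnt
  ... | no _      = refl

  ¬burnt : ∀ {ord c} → unburnt ord c ≡ true → ¬ Burnt ord c
  ¬burnt {ord} {c} eq with burnt? ord c
  ... | no ¬b = ¬b

  -- When the fire is stuck, each unburnt vertex has at least as many grains as burnt neighbours,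
  -- which by `Δ-unburnt` is the legality of firing all unburnt vertices together.
  spread : ∀ t → Burning t → Burnable u ⊎ LegalSet u
  spread t b@(burning ord settled injective burns sinkBurnt fuel)
    with any-vertex? (λ c → ¬? (burnt? ord c))
  ... | no none = inj₁ (burnable ord (λ {c} → injective (all-burnt c))
                                     (λ c → burns c (all-burnt c)))
    where
    all-burnt : ∀ c → Burnt ord c
    all-burnt c with burnt? ord c
    ... | yes burnt = burnt
    ... | no ¬b     = contradiction (c , ¬b) none
  ... | yes (c₁ , c₁-unburnt)
    with any-vertex? (λ c → ¬? (burnt? ord c) ×-dec (u c ℤ.<? burntNeighbours ord c))
  ...   | no stuck = inj₂ (legalSet (unburnt ord) (c₁ , unburnt-≡ {ord} c₁-unburnt)
            (λ c c∈C s → ¬burnt {ord} c∈C (sinkBurnt c s))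
            (λ c c∈C → ℤ.≤-trans (ℤ.≤-reflexive (Δ-unburnt ord c (¬burnt {ord} c∈C)))
                                 (ℤ.≮⇒≥ λ lt → stuck (c , ¬burnt {ord} c∈C , lt))))
  spread (ℕ.suc t) b | yes _ | yes (c , c-unburnt , lt) = spread t (burn-one b c c-unburnt lt)
  -- An unburnt vertex contributes 1 to a sum bounded by the fuel 0.
  spread ℕ.zero (burning ord _ _ _ _ fuel) | yes _ | yes (c , c-unburnt , _) =
    contradiction (ℤ.≤-trans (ℤ.≤-reflexive (cong indicator (sym (unburnt-≡ {ord} c-unburnt))))
                    (ℤ.≤-trans (term≤∑ {f = indicator ∘ unburnt ord} (λ c → indicator-nonneg (unburnt ord c)) c) fuel))
                  λ { (ℤ.+≤+ ()) }

  dhar : Burnable u ⊎ LegalSet u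
  dhar = spread (proj₁ ignite) (proj₂ ignite)

-- Parking representatives

module _ {m n : ℕ} where

  parking⇒burnable : {u : Config m n} → Parking u → Burnable u
  parking⇒burnable {u} p with dhar u
  ... | inj₁ b = b
  ... | inj₂ l = contradiction l (parking⇒illegal p)

  -- One run of the fire replaces the quantification over all sets of vertices.
  parking? : (u : Config m n) → Dec (Parking u)
  parking? u with all-vertices? (λ c → ¬? (isSink? c) →-dec (0ℤ ℤ.≤? u c)) | dhar u
  ... | no ¬0≤u | _      = no (¬0≤u ∘ proj₁)
  ... | yes 0≤u | inj₁ b = yes (burnable⇒parking 0≤u b)
  ... | yes _   | inj₂ l = no λ p → parking⇒illegal p l

  Parking-resp-≗ : {u v : Config m n} → u ≗ v → Parking u → Parking v
  Parking-resp-≗ {u} {v} u≗v (0≤u , p) =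
    (λ c c≢sink → subst (0ℤ ℤ.≤_) (u≗v c) (0≤u c c≢sink)) ,
    λ C nonempty sinkless →
      let c , c≢sink , neg = p C nonempty sinkless
      in  c , c≢sink , subst (λ x → x - Δ-set C c ℤ.< 0ℤ) (u≗v c) neg

module _ {m n : ℕ} where

  sink : Vertex (ℕ.suc m) n
  sink = inj₁ (Fin.fromℕ m)

  sink-isSink : IsSink sink
  sink-isSink = last (cong ℕ.suc (Fin.toℕ-fromℕ m))

  -- At a first maximum off the sink, `u` is less than the indegree, which is at most `u - v`; this
  -- would make `v` negative there. So the maximum is attained at the sink.
  firing≤sink : {u v : Config (ℕ.suc m) n} → Burnable u → NonNegativeOffSink v →
                (u≃v : u ≃ v) → ∀ c → firing u≃v c ℤ.≤ firing u≃v sink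
  firing≤sink {u} {v} (burnable ord _ burns) 0≤v (topple k eq) c
    with first-maximum sink ord k
  ... | c₁ , maximal , in≤L with isSink? c₁
  ...   | yes s = subst (λ c₁ → k c ℤ.≤ k c₁) (sink-unique s sink-isSink) (maximal c)
  ...   | no ¬s = contradiction (0≤v c₁ ¬s) (ℤ.<⇒≱ v<0)
    where
    diff : ∀ u v → (u - v) - (1ℤ + u) ≡ 0ℤ - (1ℤ + v)
    diff = solve-∀
    v<0 : v c₁ ℤ.< 0ℤ
    v<0 = 1+≤⇒< (≤-from-difference
      (ℤ.≤-trans (<⇒1+≤ (burns c₁ ¬s)) (ℤ.≤-trans in≤L (ℤ.≤-reflexive (sym (eq c₁)))))
      (diff (u c₁) (v c₁)))

  -- The sink is a maximum of the firing vector and, by the reverse equivalence, also a minimum. The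
  -- vector is therefore constant and its Laplacian vanishes.
  parking-unique : {u v : Config (ℕ.suc m) n} → Parking u → Parking v → u ≃ v → u ≗ v
  parking-unique {u} {v} pu pv u≃v@(topple k eq) c =
    ℤ.i-j≡0⇒i≡j (u c) (v c) (trans (eq c) (trans (L-cong constant c) (L-const (k sink) c)))
    where
    diff : ∀ x y → -1ℤ * y - -1ℤ * x ≡ x - y
    diff = solve-∀
    constant : ∀ c → k c ≡ k sink
    constant c = ℤ.≤-antisym
      (firing≤sink (parking⇒burnable pu) (proj₁ pv) u≃v c)
      (≤-from-difference (firing≤sink (parking⇒burnable pv) (proj₁ pu) (≃-sym u≃v) c)
                         (diff (k c) (k sink)))

-- Existence of parking representatives, by a decreasing weight.

module _ {m′ n′ : ℕ} where
  private
    m = ℕ.suc m′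
    n = ℕ.suc n′

  -- A potential with L height ≥ 1 off the sink: firing a set of non-sink
  -- vertices lowers ∑ height * u, while adding a large multiple of L height
  -- makes u non-negative off the sink.
  height : Vertex m n → ℤ
  height (inj₁ i) = (1ℤ + + m) - (1ℤ + + m) * indicator (does (i Fin.≟ Fin.fromℕ m′))
  height (inj₂ j) = + m

  height-off-sink : ∀ {i} → ¬ IsSink {m} {n} (inj₁ i) → height (inj₁ i) ≡ 1ℤ + + m
  height-off-sink {i} i≢sink with i Fin.≟ Fin.fromℕ m′
  ... | yes refl = contradiction (sink-isSink {m′} {n}) i≢sink
  ... | no _     = eq (1ℤ + + m)
    where
    eq : ∀ x → x - x * 0ℤ ≡ x
    eq = solve-∀

  height-sink : ∀ {c} → IsSink c → height c ≡ 0ℤ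
  height-sink {inj₁ i} s with i Fin.≟ Fin.fromℕ m′
  ... | yes _ = eq (1ℤ + + m)
    where
    eq : ∀ x → x - x * 1ℤ ≡ 0ℤ
    eq = solve-∀
  ... | no i≢ with sink-unique s (sink-isSink {m′} {n})
  ...   | refl = contradiction refl i≢

  height-nonneg : NonNegative height
  height-nonneg (inj₂ j) = ℤ.+≤+ ℕ.z≤n
  height-nonneg (inj₁ i) with isSink? {m} {n} (inj₁ i)
  ... | yes s = ℤ.≤-reflexive (sym (height-sink s))
  ... | no ¬s = subst (0ℤ ℤ.≤_) (sym (height-off-sink ¬s)) (ℤ.+≤+ ℕ.z≤n)

  -- A non-sink `inj₁` vertex lies 1 above each of its n neighbours. An `inj₂` vertex lies 1 below m
  -- - 1 neighbours and m above the sink, a net 1.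
  L-height : ∀ c → ¬ IsSink c → 1ℤ ℤ.≤ L height c
  L-height (inj₁ i) ¬s = subst (1ℤ ℤ.≤_) (sym L≡n) (ℤ.+≤+ (ℕ.s≤s ℕ.z≤n))
    where
    eq₀ : ∀ x → 0ℤ * x ≡ 0ℤ
    eq₀ = solve-∀
    eq₁ : ∀ x → 1ℤ * ((1ℤ + x) - x) ≡ 1ℤ
    eq₁ = solve-∀
    eq₂ : ∀ x → 0ℤ + x * 1ℤ ≡ x
    eq₂ = solve-∀
    L≡n : L height (inj₁ i) ≡ + n
    L≡n = trans (cong₂ _+_
      (trans (sum-cong-≗ (λ i′ → eq₀ (height (inj₁ i) - height (inj₁ i′)))) (sum-zero m))
      (trans (sum-cong-≗ {n} (λ _ → trans (cong (λ x → 1ℤ * (x - + m)) (height-off-sink ¬s)) (eq₁ (+ m))))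
             (sum-const n 1ℤ)))
      (eq₂ (+ n))
  L-height (inj₂ j) _ = ℤ.≤-reflexive (sym L≡1)
    where
    δ : Fin m → ℤ
    δ i = indicator (does (i Fin.≟ Fin.fromℕ m′))
    eq₀ : ∀ x → 0ℤ * x ≡ 0ℤ
    eq₀ = solve-∀
    eq₁ : ∀ x d → 1ℤ * (x - ((1ℤ + x) - (1ℤ + x) * d)) ≡ -1ℤ + (1ℤ + x) * d
    eq₁ = solve-∀
    eq₂ : ∀ x → (x * -1ℤ + (1ℤ + x)) + 0ℤ ≡ 1ℤ
    eq₂ = solve-∀
    L≡1 : L height (inj₂ j) ≡ 1ℤ
    L≡1 = trans (cong₂ _+_
      (trans (sum-cong-≗ (λ i → eq₁ (+ m) (δ i)))
             (trans (Sum.∑-distrib-+ (λ _ → -1ℤ) (λ i → (1ℤ + + m) * δ i))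
                    (cong₂ _+_ (sum-const m -1ℤ) (sum-δ (λ _ → 1ℤ + + m) (Fin.fromℕ m′)))))
      (trans (sum-cong-≗ {n} (λ j′ → eq₀ (+ m - + m))) (sum-zero n)))
      (eq₂ (+ m))

  weight : Config m n → ℤ
  weight u = ∑ (λ c → height c * u c)

  -- The sink has height 0, so debt there does not enter the weight.
  weight-nonneg : ∀ {u} → NonNegativeOffSink u → 0ℤ ℤ.≤ weight u
  weight-nonneg {u} 0≤u = ∑-nonneg term
    where
    term : ∀ c → 0ℤ ℤ.≤ height c * u c
    term c with isSink? c
    ... | yes s = ℤ.≤-reflexive (sym (trans (cong (_* u c) (height-sink s)) (ℤ.*-zeroˡ (u c))))
    ... | no ¬s = ℤ.≤-trans (ℤ.≤-reflexive (sym (ℤ.*-zeroʳ (height c))))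
                            (ℤ.*-monoˡ-≤-nonNeg (height c) {{ℤ.nonNegative (height-nonneg c)}} (0≤u c ¬s))

  fire : Config m n → (Vertex m n → Bool) → Config m n
  fire u C c = u c - Δ-set C c

  fire-≃ : ∀ u C → u ≃ fire u C
  fire-≃ u C = topple (indicator ∘ C) λ c → trans (eq (u c) (Δ-set C c)) (Δ-set-≡ C c)
    where
    eq : ∀ x y → x - (x - y) ≡ y
    eq = solve-∀

  fire-nonneg : ∀ {u} → NonNegativeOffSink u → (l : LegalSet u) → NonNegativeOffSink (fire u (LegalSet.set l))
  fire-nonneg {u} 0≤u (legalSet C _ _ legal) c c≢sink = ℤ.i≤j⇒0≤j-i (Δ≤u (C c) refl)
    where
    Δ≤u : ∀ b → C c ≡ b → Δ-set C c ℤ.≤ u c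
    Δ≤u true  c∈C = legal c c∈C
    Δ≤u false c∉C = ℤ.≤-trans (Δ-set-outside C c c∉C) (0≤u c c≢sink)

  -- By self-adjointness the weight drops by the sum of `L height` over the fired set, which is
  -- non-empty and avoids the sink.
  weight-fire : ∀ u (l : LegalSet u) → 1ℤ + weight (fire u (LegalSet.set l)) ℤ.≤ weight u
  weight-fire u (legalSet C (c₀ , c₀∈C) sinkless _) = ≤-from-difference 1≤drop
    (trans (cong (_- 1ℤ) drop) (eq₂ (weight u) (weight (fire u C))))
    where
    eq₁ : ∀ h x y → h * y ≡ h * x - h * (x - y)
    eq₁ = solve-∀
    eq₂ : ∀ x y → (x - y) - 1ℤ ≡ x - (1ℤ + y)
    eq₂ = solve-∀
    drop : ∑ (λ c → indicator (C c) * L height c) ≡ weight u - weight (fire u C)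
    drop = trans (L-self-adjoint (indicator ∘ C) height)
      (trans (∑-cong (λ c → trans (cong (height c *_) (sym (Δ-set-≡ C c)))
                                  (eq₁ (height c) (u c) (Δ-set C c))))
             (∑-- (λ c → height c * u c) (λ c → height c * fire u C c)))
    term : ∀ c b → C c ≡ b → 0ℤ ℤ.≤ indicator b * L height c
    term c false _   = ℤ.≤-reflexive (sym (ℤ.*-zeroˡ (L height c)))
    term c true  c∈C = ℤ.≤-trans (ℤ.+≤+ ℕ.z≤n) (ℤ.≤-trans (L-height c (sinkless c c∈C))
                         (ℤ.≤-reflexive (sym (ℤ.*-identityˡ (L height c)))))
    1≤term : 1ℤ ℤ.≤ indicator (C c₀) * L height c₀
    1≤term = subst (λ b → 1ℤ ℤ.≤ indicator b * L height c₀) (sym c₀∈C)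
      (ℤ.≤-trans (L-height c₀ (sinkless c₀ c₀∈C)) (ℤ.≤-reflexive (sym (ℤ.*-identityˡ (L height c₀)))))
    1≤drop : 1ℤ ℤ.≤ ∑ (λ c → indicator (C c) * L height c)
    1≤drop = ℤ.≤-trans 1≤term
      (term≤∑ {f = λ c → indicator (C c) * L height c} (λ c → term c (C c) refl) c₀)

  ParkingRepresentative : Config m n → Set
  ParkingRepresentative u = ∃ λ v → Parking v × u ≃ v

  settle : ∀ t u → NonNegativeOffSink u → weight u ℤ.≤ + t → ParkingRepresentative u
  settle t u 0≤u w≤t with dhar u
  ... | inj₁ b = u , burnable⇒parking 0≤u b , ≃-refl
  settle (ℕ.suc t) u 0≤u w≤t | inj₂ l@(legalSet C _ _ _) =
    let v , p , fire≃v = settle t (fire u C) (fire-nonneg 0≤u l)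
                           (≤-from-difference (ℤ.≤-trans (weight-fire u l) w≤t)
                                              (eq (+ t) (weight (fire u C))))
    in  v , p , ≃-trans (fire-≃ u C) fire≃v
    where
    eq : ∀ t w → (1ℤ + t) - (1ℤ + w) ≡ t - w
    eq = solve-∀
  settle ℕ.zero u 0≤u w≤0 | inj₂ l =
    contradiction (weight-nonneg (fire-nonneg 0≤u l))
                  (ℤ.<⇒≱ (1+≤⇒< (ℤ.≤-trans (weight-fire u l) w≤0)))

  0≤i+∣i∣ : ∀ i → 0ℤ ℤ.≤ i + + ℤ.∣ i ∣
  0≤i+∣i∣ (+ i)    = ℤ.+≤+ ℕ.z≤n
  0≤i+∣i∣ -[1+ i ] = ℤ.≤-reflexive (sym (ℤ.+-inverseˡ (+ ℕ.suc i)))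

  parkingRepresentative : ∀ u → ParkingRepresentative u
  parkingRepresentative u =
    let t , w≤t = bounded-by-ℕ (weight v)
        p , parking , v≃p = settle t v 0≤v w≤t
    in  p , parking , ≃-trans u≃v v≃p
    where
    -- The sum dominates each absolute value, so one multiple `N` repays every debt off the sink.
    bound = bounded-by-ℕ (∑ (λ c → + ℤ.∣ u c ∣))
    N = proj₁ bound
    v : Config m n
    v c = u c + + N * L height c
    u≃v : u ≃ v
    u≃v = topple (λ c → - + N * height c) λ c →
      trans (eq (u c) (+ N) (L height c)) (sym (L-*ˡ (- + N) height c))
      where
      eq : ∀ x k l → x - (x + k * l) ≡ - k * l
      eq = solve-∀
    0≤v : NonNegativeOffSink v
    0≤v c c≢sink = ℤ.≤-trans (0≤i+∣i∣ (u c)) (ℤ.+-monoʳ-≤ (u c)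
      (ℤ.≤-trans (ℤ.≤-trans (term≤∑ {f = λ c → + ℤ.∣ u c ∣} (λ _ → ℤ.+≤+ ℕ.z≤n) c) (proj₂ bound))
                 (ℤ.≤-trans (ℤ.≤-reflexive (sym (ℤ.*-identityʳ (+ N))))
                            (ℤ.*-monoˡ-≤-nonNeg (+ N) (L-height c c≢sink)))))

-- Riemann-Roch

IsMinimum-resp : ∀ {P Q : ℤ → Set} → (∀ {d} → P d → Q d) → (∀ {d} → Q d → P d) →
                 ∀ {d} → IsMinimum P d → IsMinimum Q d
IsMinimum-resp to from (p , least) = to p , λ d q → least d (from q)

IsMinimum-unique : ∀ {P : ℤ → Set} {d e} → IsMinimum P d → IsMinimum P e → d ≡ e
IsMinimum-unique (p , d≤) (q , e≤) = ℤ.≤-antisym (d≤ _ q) (e≤ _ p)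

-- The predicate local to `IsRank`, made nameable: both unfold to the same type, so minima pass
-- between them unchanged.
Obstruction : ∀ {m n} → Config m n → ℤ → Set
Obstruction {m} {n} u d = ∃ λ (f : Config m n) →
  NonNegative f × ¬ Effective (λ c → u c - f c) × degree f ≡ d

module _ {m n : ℕ} where

  -- Edges minus vertices; the genus itself is (m-1)(n-1).
  genus-1 : ℤ
  genus-1 = + m * + n - + m - + n

  κ-_ : Config m n → Config m n
  (κ- u) c = κ c - u c

  κ-κ : ∀ u → κ- (κ- u) ≗ u
  κ-κ u c = eq (κ c) (u c)
    where
    eq : ∀ k x → k - (k - x) ≡ x
    eq = solve-∀

  -κ-≃ : ∀ {u v} → u ≃ v → (κ- u) ≃ (κ- v)
  -κ-≃ {u} {v} u≃v = ≃-shift (λ c → eq (κ c) (u c) (v c)) (≃-sym u≃v)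
    where
    eq : ∀ k x y → y - x ≡ (k - x) - (k - y)
    eq = solve-∀

  degree-κ-minus : ∀ u → degree (κ- u) ≡ + 2 * genus-1 - degree u
  degree-κ-minus u = trans (∑-- (κ {m} {n}) u) (cong (_- degree u) (degree-κ {m} {n}))

  effective-degree : ∀ {u : Config m n} → Effective u → 0ℤ ℤ.≤ degree u
  effective-degree {u} eff =
    let w , 0≤w , u≃w = effective⁻¹ u eff
    in  subst (0ℤ ℤ.≤_) (sym (degree-≃ u≃w)) (∑-nonneg 0≤w)

  obstruction-nonneg : ∀ {u : Config m n} {d} → Obstruction u d → 0ℤ ℤ.≤ d
  obstruction-nonneg (f , 0≤f , _ , refl) = ∑-nonneg 0≤f

  Obstruction-resp-≃ : ∀ {u v : Config m n} {d} → u ≃ v → Obstruction u d → Obstruction v d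
  Obstruction-resp-≃ {u} {v} u≃v (f , 0≤f , ¬eff , deg) = f , 0≤f , ¬eff ∘ Effective-resp-≃
    {u = λ c → v c - f c} {v = λ c → u c - f c} (≃-shift (λ c → eq (u c) (v c) (f c)) (≃-sym u≃v)) , deg
    where
    eq : ∀ x y z → y - x ≡ (y - z) - (x - z)
    eq = solve-∀

  -- If u - f is equivalent to p ≤ ν, then e = ν - p obstructs κ - u: adding f
  -- to κ - u - e gives a configuration equivalent to κ - ν, which is the ν of
  -- the reversed order.
  obstruction-from-order : Vertex m n → ∀ {u f p : Config m n} {ord} → Injective ord →
    NonNegative f → (λ c → u c - f c) ≃ p → NonNegative (λ c → ν ord c - p c) →
    Obstruction (κ- u) (degree f + genus-1 - degree u)
  obstruction-from-order c₀ {u} {f} {p} {ord} inj 0≤f u-f≃p 0≤e = e , 0≤e , e-obstructs , degree-e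
    where
    e : Config m n
    e c = ν ord c - p c
    eq₁ : ∀ f u g → g - (u - f) ≡ f + g - u
    eq₁ = solve-∀
    degree-e : degree e ≡ degree f + genus-1 - degree u
    degree-e = trans (∑-- (ν ord) p) (trans
      (cong₂ _-_ (degree-ν inj) (trans (sym (degree-≃ u-f≃p)) (∑-- u f)))
      (eq₁ (degree f) (degree u) genus-1))
    eq₂ : ∀ v v′ u f p w → ((v′ + v) - u - (v - p)) - w + ((u - f) - p) ≡ v′ - (w + f)
    eq₂ = solve-∀
    ν-effective : ∀ {w} → NonNegative w → (λ c → (κ- u) c - e c) ≃ w → Effective (ν (reverse ord))
    ν-effective {w} 0≤w (topple k eq) = effective
      {u = ν (reverse ord)} {w = λ c → w c + f c} (λ c → ℤ.+-mono-≤ (0≤w c) (0≤f c))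
      (topple (λ c → k c + firing u-f≃p c) λ c → trans
        (sym (eq₂ (ν ord c) (ν (reverse ord) c) (u c) (f c) (p c) (w c)))
        (trans (cong (λ x → (x - u c - e c) - w c + ((u c - f c) - p c)) (ν-reverse inj c))
               (trans (cong₂ _+_ (eq c) (equation u-f≃p c)) (sym (L-+ k (firing u-f≃p) c)))))
    e-obstructs : ¬ Effective (λ c → (κ- u) c - e c)
    e-obstructs eff =
      let w , 0≤w , ≃w = effective⁻¹ (λ c → (κ- u) c - e c) eff
      in  ν-not-effective c₀ (reverse ord) (ν-effective 0≤w ≃w)

  -- Effectiveness passes upwards: adding `ν ord - p` to an effective `p` would make `ν ord`
  -- effective.
  below-ν-ineffective : Vertex m n → ∀ {p : Config m n} ord →
    NonNegative (λ c → ν ord c - p c) → ¬ Effective p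
  below-ν-ineffective c₀ {p} ord 0≤ν-p eff =
    let w , 0≤w , p≃w = effective⁻¹ p eff
    in  ν-not-effective c₀ ord (effective {u = ν ord} {w = λ c → (ν ord c - p c) + w c}
          (λ c → ℤ.+-mono-≤ (0≤ν-p c) (0≤w c))
          (≃-shift (λ c → eq (ν ord c) (p c) (w c)) p≃w))
    where
    eq : ∀ v p w → p - w ≡ v - ((v - p) + w)
    eq = solve-∀

-- Existence of the rank by finite search.

least : ∀ {P : ℕ → Set} → (∀ d → Dec (P d)) → ∀ d → P d → ∃ λ d → P d × (∀ e → P e → d ℕ.≤ e)
least P? d p with P? 0
... | yes p₀ = 0 , p₀ , λ _ _ → ℕ.z≤n
least P? ℕ.zero    p | no ¬p₀ = contradiction p ¬p₀
least P? (ℕ.suc d) p | no ¬p₀ with least (P? ∘ ℕ.suc) d p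
... | d , p , d≤ = ℕ.suc d , p , λ { ℕ.zero p₀ → contradiction p₀ ¬p₀ ; (ℕ.suc e) pₑ → ℕ.s≤s (d≤ e pₑ) }

module _ {m n : ℕ} (B : ℕ) where

  private
    decode : Fin (ℕ.suc B ℕ.^ (m ℕ.+ n)) → Config m n
    decode k c = + toℕ (Fin.finToFun {ℕ.suc B} {m ℕ.+ n} k (Fin.join m n c))

  box : List (Config m n)
  box = List.map decode (List.allFin (ℕ.suc B ℕ.^ (m ℕ.+ n)))

  ∈-box : ∀ {f} → NonNegative f → (∀ c → f c ℤ.≤ + B) → ∃ λ g → g ∈ box × f ≗ g
  ∈-box {f} 0≤f f≤B = decode (Fin.funToFin digit) , ∈-map⁺ decode (∈-allFin (Fin.funToFin digit)) , f≗g
    where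
    abs≡ : ∀ c → + ℤ.∣ f c ∣ ≡ f c
    abs≡ c = ℤ.0≤i⇒+∣i∣≡i (0≤f c)
    bound : ∀ c → ℤ.∣ f c ∣ ℕ.< ℕ.suc B
    bound c = ℕ.s≤s (ℤ.drop‿+≤+ (subst (ℤ._≤ + B) (sym (abs≡ c)) (f≤B c)))
    digit : Fin (m ℕ.+ n) → Fin (ℕ.suc B)
    digit x = Fin.fromℕ< (bound (Fin.splitAt m x))
    f≗g : f ≗ decode (Fin.funToFin digit)
    f≗g c = sym (trans (cong (+_ ∘ toℕ) (Fin.finToFun-funToFin digit (Fin.join m n c)))
      (trans (cong +_ (Fin.toℕ-fromℕ< (bound (Fin.splitAt m (Fin.join m n c)))))
             (trans (cong (λ c → + ℤ.∣ f c ∣) (Fin.splitAt-join m n c)) (abs≡ c))))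

module _ {m n : ℕ} (effective? : (u : Config m n) → Dec (Effective u)) (c₀ : Vertex m n) where

  -- A non-negative configuration of degree `d` has all values at most `d`, so `box d` contains
  -- every candidate up to pointwise equality.
  obstruction? : ∀ (u : Config m n) d → Dec (Obstruction u (+ d))
  obstruction? u d = map′ to from (Any.any? candidate? (box d))
    where
    Candidate : Config m n → Set
    Candidate f = NonNegative f × ¬ Effective (λ c → u c - f c) × degree f ≡ + d
    candidate? : ∀ f → Dec (Candidate f)
    candidate? f = all-vertices? (λ c → 0ℤ ℤ.≤? f c)
      ×-dec ¬? (effective? (λ c → u c - f c))
      ×-dec (degree f ℤ.≟ + d)
    to : Any Candidate (box d) → Obstruction u (+ d)
    to found = let f , _ , candidate = find found in f , candidate
    from : Obstruction u (+ d) → Any Candidate (box d)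
    from (f , 0≤f , ¬eff , deg) with ∈-box d 0≤f
      (λ c → ℤ.≤-trans (term≤∑ 0≤f c) (ℤ.≤-reflexive deg))
    ... | g , g∈box , f≗g = lose g∈box
      ( (λ c → subst (0ℤ ℤ.≤_) (f≗g c) (0≤f c))
      , ¬eff ∘ Effective-resp-≃ {u = λ c → u c - g c} {v = λ c → u c - f c}
            (≗⇒≃ λ c → cong (_-_ (u c)) (sym (f≗g c)))
      , trans (∑-cong (sym ∘ f≗g)) deg)

  -- Removing more grains than the degree of `u` leaves a negative degree, which no effective
  -- configuration has.
  obstruction-exists : ∀ (u : Config m n) → ∃ λ d → Obstruction u (+ d)
  obstruction-exists u = ℕ.suc t , f , 0≤f , (λ eff → ℤ.<⇒≱ negative (effective-degree {u = λ c → u c - f c} eff)) , degree-f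
    where
    t = proj₁ (bounded-by-ℕ (degree u))
    f : Config m n
    f c = + ℕ.suc t * indicator (does (c ≟ c₀))
    0≤f : NonNegative f
    0≤f c with does (c ≟ c₀)
    ... | true  = ℤ.+≤+ ℕ.z≤n
    ... | false = ℤ.≤-reflexive (sym (ℤ.*-zeroʳ (+ ℕ.suc t)))
    degree-f : degree f ≡ + ℕ.suc t
    degree-f = ∑-δ (λ _ → + ℕ.suc t) c₀
    eq : ∀ t x → t - x ≡ 0ℤ - (1ℤ + (x - (1ℤ + t)))
    eq = solve-∀
    negative : degree (λ c → u c - f c) ℤ.< 0ℤ
    negative = 1+≤⇒< (≤-from-difference (proj₂ (bounded-by-ℕ (degree u)))
      (trans (eq (+ t) (degree u))
             (cong (λ x → 0ℤ - (1ℤ + x)) (sym (trans (∑-- u f) (cong (_-_ (degree u)) degree-f))))))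

  minimal-obstruction : ∀ (u : Config m n) → ∃ λ d → IsMinimum (Obstruction u) (+ d)
  minimal-obstruction u =
    let d₀ , o₀ = obstruction-exists u
        d , o , d≤ = least (obstruction? u) d₀ o₀
    in  d , o , minimal d≤
    where
    minimal : ∀ {d} → (∀ e → Obstruction u (+ e) → d ℕ.≤ e) → ∀ d′ → Obstruction u d′ → + d ℤ.≤ d′
    minimal d≤ (+ e)    o′ = ℤ.+≤+ (d≤ e o′)
    minimal d≤ -[1+ e ] o′ = contradiction (obstruction-nonneg {u = u} o′) λ ()

-- The duality of obstructions and the exponents as minima.

module _ {m′ n′ : ℕ} where
  private
    m = ℕ.suc m′
    n = ℕ.suc n′

  -- Burning gives `p` less than the indegree off the sink; a negative sink value extends the
  -- inequality to the sink, where the indegree is at least 0.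
  negative-parking : {p : Config m n} → Parking p → p sink ℤ.< 0ℤ →
    ∃ λ ord → Injective ord × NonNegative (λ c → ν ord c - p c)
  negative-parking {p} parking p<0 with parking⇒burnable parking
  ... | burnable ord inj burns = ord , inj , λ c → ℤ.i≤j⇒0≤j-i (p≤ν c (isSink? c))
    where
    diff : ∀ x y → y - (1ℤ + x) ≡ (y - 1ℤ) - x
    diff = solve-∀
    p<in : ∀ c → Dec (IsSink c) → p c ℤ.< indegree ord c
    p<in c (no ¬s) = burns c ¬s
    p<in c (yes s) = ℤ.<-≤-trans (subst (λ c → p c ℤ.< 0ℤ) (sink-unique sink-isSink s) p<0)
      (∑-nonneg λ c′ → ℤ.≤-trans (ℤ.≤-reflexive (sym (ℤ.*-zeroʳ (adj c c′))))
        (indicator-*-mono (adjacent c c′) (indicator-nonneg (does (ord c′ ℤ.<? ord c)))))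
    p≤ν : ∀ c → Dec (IsSink c) → p c ℤ.≤ ν ord c
    p≤ν c s? = ≤-from-difference (<⇒1+≤ (p<in c s?)) (diff (p c) (indegree ord c))

  negative-parking-ineffective : {p : Config m n} → Parking p → p sink ℤ.< 0ℤ → ¬ Effective p
  negative-parking-ineffective parking p<0 =
    let ord , _ , 0≤ν-p = negative-parking parking p<0
    in  below-ν-ineffective sink ord 0≤ν-p

  parking-effective : {p : Config m n} → Parking p → 0ℤ ℤ.≤ p sink → NonNegative p
  parking-effective {p} (0≤p , _) 0≤sink c = nonneg (isSink? c)
    where
    nonneg : Dec (IsSink c) → 0ℤ ℤ.≤ p c
    nonneg (yes s) = subst (λ c → 0ℤ ℤ.≤ p c) (sink-unique sink-isSink s) 0≤sink
    nonneg (no ¬s) = 0≤p c ¬s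

  -- If the sink value of the parking representative is non-negative, the representative is itself
  -- the witness; if negative, the representative lies below some `ν`.
  effective? : (u : Config m n) → Dec (Effective u)
  effective? u = decide (0ℤ ℤ.≤? p sink)
    where
    representative = parkingRepresentative u
    p = proj₁ representative
    parking : Parking p
    parking = proj₁ (proj₂ representative)
    u≃p : u ≃ p
    u≃p = proj₂ (proj₂ representative)
    decide : Dec (0ℤ ℤ.≤ p sink) → Dec (Effective u)
    decide (yes 0≤p) = yes (effective (parking-effective parking 0≤p) u≃p)
    decide (no ¬0≤p) = no λ eff →
      negative-parking-ineffective parking (ℤ.≰⇒> ¬0≤p) (Effective-resp-≃ u≃p eff)

  ineffective-representative : ∀ u → ¬ Effective u →
    ∃ λ (p : Config m n) → Parking p × u ≃ p × p sink ℤ.< 0ℤ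
  ineffective-representative u ¬eff =
    let p , parking , u≃p = parkingRepresentative u
    in  p , parking , u≃p , ℤ.≰⇒> λ 0≤p → ¬eff (effective (parking-effective parking 0≤p) u≃p)

  obstruction-from-parking : ∀ (u f p : Config m n) → NonNegative f →
    Parking p × (λ c → u c - f c) ≃ p × p sink ℤ.< 0ℤ →
    Obstruction (κ- u) (degree f + genus-1 {m} {n} - degree u)
  obstruction-from-parking u f p 0≤f (parking , u-f≃p , p<0) =
    let ord , inj , 0≤ν-p = negative-parking parking p<0
    in  obstruction-from-order sink {u} {f} {p} {ord} inj 0≤f u-f≃p 0≤ν-p

  obstruction-dual : ∀ {u : Config m n} {d} → Obstruction u d →
                     Obstruction (κ- u) (d + genus-1 {m} {n} - degree u)
  obstruction-dual {u} (f , 0≤f , ¬eff , deg) =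
    let p , negative = ineffective-representative (λ c → u c - f c) ¬eff
    in  subst (λ d → Obstruction (κ- u) (d + genus-1 {m} {n} - degree u)) deg
          (obstruction-from-parking u f p 0≤f negative)

  -- Since `κ` has degree twice `genus-1`, the degree shift of `obstruction-dual` for `κ- u` undoes
  -- the one for `u`. So an obstruction of `κ- u` below the claimed minimum would yield one of `u`
  -- below `d`.
  riemann-roch : ∀ {u : Config m n} {d} → IsMinimum (Obstruction u) d →
                 IsMinimum (Obstruction (κ- u)) (d + genus-1 {m} {n} - degree u)
  riemann-roch {u} {d} (obstruction , d≤) = obstruction-dual {u} obstruction , λ d′ o →
    ≤-from-difference (d≤ (d′ + g - degree (κ- u)) (double-dual d′ o))
      (trans (cong (λ x → d′ + g - x - d) (degree-κ-minus u)) (eq d d′ g (degree u)))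
    where
    g = genus-1 {m} {n}
    eq : ∀ d d′ g x → d′ + g - (+ 2 * g - x) - d ≡ d′ - (d + g - x)
    eq = solve-∀
    double-dual : ∀ d′ → Obstruction (κ- u) d′ → Obstruction u (d′ + g - degree (κ- u))
    double-dual d′ o = Obstruction-resp-≃ {u = κ- (κ- u)} (≗⇒≃ (κ-κ u)) (obstruction-dual {κ- u} o)

  minimum : (u : Config m n) → ∃ λ d → IsMinimum (Obstruction u) (+ d)
  minimum = minimal-obstruction effective? sink

  -- Rank plus 1 is the least degree of an obstruction, and (m-1)(n-1) - 1 is `genus-1`. In this
  -- form exchanging `u` and `κ- u` visibly exchanges the exponents.
  hasMonomial⇒ : ∀ {u : Config m n} {i j} → HasMonomial u i j →
    IsMinimum (Obstruction (κ- u)) (+ i) × IsMinimum (Obstruction u) (+ j)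
  hasMonomial⇒ {u} {i} {j} (r , (d , minⱼ , refl) , x≡i , y≡j) =
    subst (IsMinimum (Obstruction (κ- u)))
          (trans (eq₁ (+ m) (+ n) d (degree u)) x≡i) (riemann-roch {u} minⱼ) ,
    subst (IsMinimum (Obstruction u)) (trans (eq₂ d) y≡j) minⱼ
    where
    eq₁ : ∀ m n d x → d + (m * n - m - n) - x ≡ (m - 1ℤ) * (n - 1ℤ) + (-1ℤ + d) - x
    eq₁ = solve-∀
    eq₂ : ∀ d → d ≡ (-1ℤ + d) + 1ℤ
    eq₂ = solve-∀

  ⇒hasMonomial : ∀ {u : Config m n} {i j} → IsMinimum (Obstruction (κ- u)) (+ i) →
    IsMinimum (Obstruction u) (+ j) → HasMonomial u i j
  ⇒hasMonomial {u} {i} {j} minᵢ minⱼ = -1ℤ + + j , (+ j , minⱼ , refl) ,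
    trans (eq₁ (+ m) (+ n) (+ j) (degree u)) (IsMinimum-unique {P = Obstruction (κ- u)} (riemann-roch {u} minⱼ) minᵢ) ,
    eq₂ (+ j)
    where
    eq₁ : ∀ m n d x → (m - 1ℤ) * (n - 1ℤ) + (-1ℤ + d) - x ≡ d + (m * n - m - n) - x
    eq₁ = solve-∀
    eq₂ : ∀ d → (-1ℤ + d) + 1ℤ ≡ d
    eq₂ = solve-∀

  monomial : ∀ (u : Config m n) → ∃₂ λ i j → HasMonomial u i j
  monomial u =
    let i , minᵢ = minimum (κ- u)
        j , minⱼ = minimum u
    in  i , j , ⇒hasMonomial {u} minᵢ minⱼ

  HasMonomial-unique : ∀ (u : Config m n) {i j i′ j′} →
    HasMonomial u i j → HasMonomial u i′ j′ → i ≡ i′ × j ≡ j′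
  HasMonomial-unique u h h′ =
    let minᵢ  , minⱼ  = hasMonomial⇒ {u} h
        minᵢ′ , minⱼ′ = hasMonomial⇒ {u} h′
    in  ℤ.+-injective (IsMinimum-unique {P = Obstruction (κ- u)} minᵢ minᵢ′) ,
        ℤ.+-injective (IsMinimum-unique {P = Obstruction u} minⱼ minⱼ′)

  hasMonomial? : ∀ (u : Config m n) i j → Dec (HasMonomial u i j)
  hasMonomial? u i j =
    let i′ , j′ , h = monomial u
    in  map′ (λ (i≡ , j≡) → subst₂ (HasMonomial u) i≡ j≡ h) (HasMonomial-unique u h)
             (i′ ℕ.≟ i ×-dec j′ ℕ.≟ j)

-- Symmetries and sorting

module _ {A : Set} {_≲_ : A → A → Set}
  (total : ∀ x y → x ≲ y ⊎ y ≲ x) (transitive : ∀ {x y z} → x ≲ y → y ≲ z → x ≲ z) where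

  -- Selection sort: `i₀` indexes a least value and goes to the front, and the recursion treats the
  -- indices other than `i₀`.
  sorting-permutation : ∀ {n} (f : Fin n → A) → ∃ λ (π : Permutation′ n) →
    ∀ i j → i Fin.≤ j → f (π ⟨$⟩ʳ i) ≲ f (π ⟨$⟩ʳ j)
  sorting-permutation {ℕ.zero}  f = Perm.id , λ ()
  sorting-permutation {ℕ.suc n} f
    with maximum {_≲_ = λ i j → f j ≲ f i} (λ i j → total (f j) (f i)) (λ p q → transitive q p)
                 zero (List.allFin (ℕ.suc n))
  ... | i₀ , _ ∷ least with sorting-permutation (f ∘ Fin.punchIn i₀)
  ...   | π , sorted = Perm.insert zero i₀ π , sorted′
    where
    suc-eq : ∀ i → f (Fin.punchIn i₀ (π ⟨$⟩ʳ i)) ≡ f (Perm.insert zero i₀ π ⟨$⟩ʳ suc i)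
    suc-eq i = cong f (sym (Perm.insert-punchIn zero i₀ π i))
    sorted′ : ∀ i j → i Fin.≤ j →
              f (Perm.insert zero i₀ π ⟨$⟩ʳ i) ≲ f (Perm.insert zero i₀ π ⟨$⟩ʳ j)
    sorted′ zero    j       _   = All.lookup least (∈-allFin (Perm.insert zero i₀ π ⟨$⟩ʳ j))
    sorted′ (suc i) (suc j) i≤j = subst₂ _≲_ (suc-eq i) (suc-eq j) (sorted i j (ℕ.s≤s⁻¹ i≤j))

-- By the pigeonhole principle some j ≤ i has i ≤ π j.
sorted-permuted-≤ : ∀ {n} {f g : Fin n → ℤ} (N : Fin n → Set) (π : Permutation′ n) →
  (∀ {i j} → i Fin.≤ j → N j → N i) → (∀ {i} → N i → N (π ⟨$⟩ʳ i)) →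
  (∀ i j → N i → N j → i Fin.≤ j → f i ℤ.≤ f j) →
  (∀ i j → N i → N j → i Fin.≤ j → g i ℤ.≤ g j) →
  (∀ i → f i ≡ g (π ⟨$⟩ʳ i)) → ∀ i → N i → g i ℤ.≤ f i
sorted-permuted-≤ N π closed invariant f↗ g↗ f≡g∘π i Nᵢ
  with Fin.injective⇒existsPivot (Injection.injective (↔⇒↣ π)) i
... | j , j≤i , i≤πj = ℤ.≤-trans (g↗ i (π ⟨$⟩ʳ j) Nᵢ (invariant Nⱼ) i≤πj)
                         (ℤ.≤-trans (ℤ.≤-reflexive (sym (f≡g∘π j))) (f↗ j i Nⱼ Nᵢ j≤i))
  where Nⱼ = closed j≤i Nᵢ

record Symmetry (m n : ℕ) : Set where
  constructor symmetry
  field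
    πᴬ : Permutation′ m
    πᴮ : Permutation′ n
    fixesSink : ∀ {i} → IsSink {m} {n} (inj₁ i) → πᴬ ⟨$⟩ʳ i ≡ i

module _ {m n : ℕ} where

  permute : Symmetry m n → Vertex m n → Vertex m n
  permute (symmetry π ρ _) (inj₁ i) = inj₁ (π ⟨$⟩ʳ i)
  permute (symmetry π ρ _) (inj₂ j) = inj₂ (ρ ⟨$⟩ʳ j)

  inverse : Symmetry m n → Symmetry m n
  inverse (symmetry π ρ fixes) = symmetry (Perm.flip π) (Perm.flip ρ)
    λ {i} s → trans (cong (π ⟨$⟩ˡ_) (sym (fixes s))) (Perm.inverseˡ π)

  _∙_ : Symmetry m n → Symmetry m n → Symmetry m n
  symmetry π ρ fixes ∙ symmetry π′ ρ′ fixes′ = symmetry (π′ Perm.∘ₚ π) (ρ′ Perm.∘ₚ ρ)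
    λ s → trans (cong (π ⟨$⟩ʳ_) (fixes′ s)) (fixes s)

  permute-∙ : ∀ σ τ c → permute (σ ∙ τ) c ≡ permute σ (permute τ c)
  permute-∙ σ τ (inj₁ i) = refl
  permute-∙ σ τ (inj₂ j) = refl

  permute-inverseʳ : ∀ σ c → permute σ (permute (inverse σ) c) ≡ c
  permute-inverseʳ (symmetry π ρ _) (inj₁ i) = cong inj₁ (Perm.inverseʳ π)
  permute-inverseʳ (symmetry π ρ _) (inj₂ j) = cong inj₂ (Perm.inverseʳ ρ)

  permute-inverseˡ : ∀ σ c → permute (inverse σ) (permute σ c) ≡ c
  permute-inverseˡ (symmetry π ρ _) (inj₁ i) = cong inj₁ (Perm.inverseˡ π)
  permute-inverseˡ (symmetry π ρ _) (inj₂ j) = cong inj₂ (Perm.inverseˡ ρ)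

  permute-sink : ∀ σ {c} → IsSink c → permute σ c ≡ c
  permute-sink (symmetry _ _ fixes) s@(last _) = cong inj₁ (fixes s)

  permute-off-sink : ∀ σ {c} → ¬ IsSink c → ¬ IsSink (permute σ c)
  permute-off-sink σ {c} ¬s s = ¬s (subst IsSink c≡ s)
    where
    c≡ : permute σ c ≡ c
    c≡ = trans (sym (permute-sink (inverse σ) s)) (permute-inverseˡ σ c)

  ∑-permute : ∀ σ (f : Vertex m n → ℤ) → ∑ (f ∘ permute σ) ≡ ∑ f
  ∑-permute (symmetry π ρ _) f =
    sym (cong₂ _+_ (Sum.sum-permute (f ∘ inj₁) π) (Sum.sum-permute (f ∘ inj₂) ρ))

  adj-permute : ∀ σ c c′ → adj (permute σ c) (permute σ c′) ≡ adj c c′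
  adj-permute σ (inj₁ _) (inj₁ _) = refl
  adj-permute σ (inj₁ _) (inj₂ _) = refl
  adj-permute σ (inj₂ _) (inj₁ _) = refl
  adj-permute σ (inj₂ _) (inj₂ _) = refl

  κ-permute : ∀ σ c → κ (permute σ c) ≡ κ c
  κ-permute σ (inj₁ _) = refl
  κ-permute σ (inj₂ _) = refl

  ∑-adj-permute : ∀ σ c (f : Vertex m n → ℤ) →
    ∑ (λ c′ → adj c c′ * f (permute σ c′)) ≡ ∑ (λ c′ → adj (permute σ c) c′ * f c′)
  ∑-adj-permute σ c f = trans
    (∑-cong λ c′ → cong (_* f (permute σ c′)) (sym (adj-permute σ c c′)))
    (∑-permute σ (λ c′ → adj (permute σ c) c′ * f c′))

  L-permute : ∀ σ k c → L (k ∘ permute σ) c ≡ L k (permute σ c)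
  L-permute σ k c = ∑-adj-permute σ c (λ c′ → k (permute σ c) - k c′)

  ≃-permute : ∀ σ {u v : Config m n} → u ≃ v → (u ∘ permute σ) ≃ (v ∘ permute σ)
  ≃-permute σ (topple k eq) = topple (k ∘ permute σ) λ c →
    trans (eq (permute σ c)) (sym (L-permute σ k c))

  effective-permute : ∀ σ {u : Config m n} → Effective u → Effective (u ∘ permute σ)
  effective-permute σ {u} eff =
    let w , 0≤w , u≃w = effective⁻¹ u eff
    in  effective (0≤w ∘ permute σ) (≃-permute σ u≃w)

  obstruction-permute : ∀ σ {u : Config m n} {d} → Obstruction u d → Obstruction (u ∘ permute σ) d
  obstruction-permute σ {u} (f , 0≤f , ¬eff , deg) =
    f ∘ permute σ , 0≤f ∘ permute σ ,
    (λ eff → ¬eff (Effective-resp-≃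
      {u = λ c → u (permute σ (permute (inverse σ) c)) - f (permute σ (permute (inverse σ) c))}
      (≗⇒≃ λ c → cong (λ c → u c - f c) (permute-inverseʳ σ c))
      (effective-permute (inverse σ) {λ c → u (permute σ c) - f (permute σ c)} eff))) ,
    trans (∑-permute σ f) deg

  minimum-permute : ∀ σ {u : Config m n} {d} → IsMinimum (Obstruction u) d →
                    IsMinimum (Obstruction (u ∘ permute σ)) d
  minimum-permute σ {u} = IsMinimum-resp {Obstruction u} {Obstruction (u ∘ permute σ)}
    (obstruction-permute σ {u})
    λ o → Obstruction-resp-≃ (≗⇒≃ λ c → cong u (permute-inverseʳ σ c))
            (obstruction-permute (inverse σ) {u ∘ permute σ} o)

  minimum-resp-≃ : {u v : Config m n} {d : ℤ} → u ≃ v →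
                   IsMinimum (Obstruction u) d → IsMinimum (Obstruction v) d
  minimum-resp-≃ {u} {v} u≃v = IsMinimum-resp {Obstruction u} {Obstruction v} (Obstruction-resp-≃ u≃v) (Obstruction-resp-≃ (≃-sym u≃v))

  -- The burning order is pulled back along `σ`, so no set of vertices has to be transported.
  parking-permute : ∀ σ {u : Config m n} → Parking u → Parking (u ∘ permute σ)
  parking-permute σ {u} p with parking⇒burnable p
  ... | burnable ord inj burns = burnable⇒parking
    (λ c ¬s → proj₁ p (permute σ c) (permute-off-sink σ ¬s))
    (burnable (ord ∘ permute σ)
      (λ {c} {c′} eq → trans (sym (permute-inverseˡ σ c))
        (trans (cong (permute (inverse σ)) (inj eq)) (permute-inverseˡ σ c′)))
      (λ c ¬s → ℤ.<-≤-trans (burns (permute σ c) (permute-off-sink σ ¬s))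
        (ℤ.≤-reflexive (sym (∑-adj-permute σ c (λ c′ → before ord c′ (permute σ c)))))))

  sorted-unique : ∀ σ {u v : Config m n} → Sorted u → Sorted v → u ≗ v ∘ permute σ →
                  ∀ c → ¬ IsSink c → v c ℤ.≤ u c
  sorted-unique σ@(symmetry π ρ _) (u↗ᴬ , _) (v↗ᴬ , _) u≗ (inj₁ i) =
    sorted-permuted-≤ (λ i → ¬ IsSink {m} {n} (inj₁ i)) π
      -- The sink has the last index, so the non-sink indices are closed downwards.
      (λ { {i} {j} i≤j ¬s (last eq) → ¬s (last (ℕ.≤-antisym (Fin.toℕ<n j) (subst (ℕ._≤ ℕ.suc (toℕ j)) eq (ℕ.s≤s i≤j)))) })
      (permute-off-sink σ) u↗ᴬ v↗ᴬ (u≗ ∘ inj₁) i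
  sorted-unique σ@(symmetry π ρ _) {u} {v} (_ , u↗ᴮ) (_ , v↗ᴮ) u≗ (inj₂ j) _ =
    sorted-permuted-≤ {f = u ∘ inj₂} {v ∘ inj₂} (λ _ → ⊤) ρ _ _ (λ i j _ _ → u↗ᴮ i j) (λ i j _ _ → v↗ᴮ i j) (u≗ ∘ inj₂) j _

  -- Off the sink, `σ` and its inverse give the two inequalities; the sink is exempt from sorting
  -- but fixed by `σ`.
  sorted-permuted-≗ : ∀ σ {u v : Config m n} → Sorted u → Sorted v → u ≗ v ∘ permute σ → u ≗ v
  sorted-permuted-≗ σ {u} {v} u↗ v↗ u≗ c with isSink? c
  ... | yes s = trans (u≗ c) (cong v (permute-sink σ s))
  ... | no ¬s = ℤ.≤-antisym
    (sorted-unique (inverse σ) v↗ u↗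
      (λ c → sym (trans (u≗ (permute (inverse σ) c)) (cong v (permute-inverseʳ σ c)))) c ¬s)
    (sorted-unique σ u↗ v↗ u≗ c ¬s)

module _ {m n : ℕ} where

  -- Indices are sorted instead of values, under a preorder that puts the sink on top whatever its
  -- value, so that the resulting permutation fixes it.
  sort : (u : Config (ℕ.suc m) n) → ∃ λ σ → Sorted (u ∘ permute σ)
  sort u with sorting-permutation {_≲_ = _≲_} total transitive (λ i → i)
            | sorting-permutation {_≲_ = ℤ._≤_} ℤ.≤-total ℤ.≤-trans (u ∘ inj₂)
    where
    SinkA : Fin (ℕ.suc m) → Set
    SinkA i = IsSink {ℕ.suc m} {n} (inj₁ i)
    _≲_ : Fin (ℕ.suc m) → Fin (ℕ.suc m) → Set
    i ≲ j = SinkA j ⊎ (¬ SinkA i × u (inj₁ i) ℤ.≤ u (inj₁ j))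
    total : ∀ i j → i ≲ j ⊎ j ≲ i
    total i j with isSink? {ℕ.suc m} {n} (inj₁ i) | isSink? {ℕ.suc m} {n} (inj₁ j)
                 | ℤ.≤-total (u (inj₁ i)) (u (inj₁ j))
    ... | yes s | _      | _      = inj₂ (inj₁ s)
    ... | no _  | yes s  | _      = inj₁ (inj₁ s)
    ... | no ¬s | no _   | inj₁ p = inj₁ (inj₂ (¬s , p))
    ... | no _  | no ¬s  | inj₂ p = inj₂ (inj₂ (¬s , p))
    transitive : ∀ {i j k} → i ≲ j → j ≲ k → i ≲ k
    transitive _              (inj₁ s)        = inj₁ s
    transitive (inj₁ s)       (inj₂ (¬s , _)) = contradiction s ¬s
    transitive (inj₂ (¬s , p)) (inj₂ (_ , q)) = inj₂ (¬s , ℤ.≤-trans p q)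
  ... | π , sortedᴬ | ρ , sortedᴮ = σ , ascending , sortedᴮ
    where
    top = Fin.fromℕ m
    -- The position that `π` sends to `top` is at most `top`, so the sink index is below
    -- `π ⟨$⟩ʳ top` in the preorder; only the sink itself can be above the sink.
    πtop : IsSink {ℕ.suc m} {n} (inj₁ (π ⟨$⟩ʳ top))
    πtop with sortedᴬ (π ⟨$⟩ˡ top) top (Fin.≤fromℕ (π ⟨$⟩ˡ top))
    ... | inj₁ s        = s
    ... | inj₂ (¬s , _) rewrite Perm.inverseʳ π {top} = contradiction sink-isSink ¬s
    fixes : ∀ {i} → IsSink {ℕ.suc m} {n} (inj₁ i) → π ⟨$⟩ʳ i ≡ i
    fixes {i} s with sink-unique s (sink-isSink {m} {n})
    ... | refl with sink-unique πtop (sink-isSink {m} {n})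
    ...   | eq = inj₁-injective eq
    σ = symmetry π ρ fixes
    ascending : ∀ i i′ → ¬ IsSink {ℕ.suc m} {n} (inj₁ i) → ¬ IsSink {ℕ.suc m} {n} (inj₁ i′) →
                i Fin.≤ i′ → u (inj₁ (π ⟨$⟩ʳ i)) ℤ.≤ u (inj₁ (π ⟨$⟩ʳ i′))
    ascending i i′ _ ¬s′ i≤i′ with sortedᴬ i i′ i≤i′
    ... | inj₁ s       = contradiction s (permute-off-sink σ ¬s′)
    ... | inj₂ (_ , p) = p

-- Counting

module _ {m n m′ n′ : ℕ} where

  Count-injection : ∀ {P : Config m n → Set} {Q : Config m′ n′ → Set} {M N} →
    Count P M → Count Q N → (φ : ∀ u → P u → ∃ Q) →
    (∀ {u v} (p : P u) (q : P v) → proj₁ (φ u p) ≗ proj₁ (φ v q) → u ≗ v) → M ℕ.≤ N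
  Count-injection (us , unique , all , _ , refl) (vs , _ , _ , complete , refl) φ injective =
    Fin.injective⇒≤ {f = Any.index ∘ position} λ {k} {l} eq →
      lookup-injective unique (injective (member k) (member l)
        (index-injective (configSetoid m′ n′) (position k) (position l) eq))
    where
    member = λ k → All.lookup all (∈-lookup {xs = us} k)
    image = λ k → φ (List.lookup us k) (member k)
    position = λ k → complete (proj₁ (image k)) (proj₂ (image k))

module _ {m n : ℕ} where
  private
    S = configSetoid m n
    _≗?_ : (u v : Config m n) → Dec (u ≗ v)
    u ≗? v = all-vertices? (λ c → u c ℤ.≟ v c)
    DS : DecSetoid _ _
    DS = record { isDecEquivalence = record
      { isEquivalence = Setoid.isEquivalence S ; _≟_ = _≗?_ } }

  finite-count : ∀ {P : Config m n → Set} → (∀ u → Dec (P u)) → (∀ {u v} → u ≗ v → P u → P v) →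
    (us : List (Config m n)) → (∀ u → P u → Any (u ≗_) us) → ∃ (Count P)
  finite-count P? P-resp us complete =
    _ , List.deduplicate _≗?_ (List.filter P? us)
      , deduplicate-! DS (List.filter P? us)
      , deduplicate⁺ _≗?_ (all-filter P? us)
      , (λ u p → ∈-deduplicate⁺ S _≗?_ (λ v≗w u≗v c → trans (u≗v c) (sym (v≗w c)))
                   (∈-filter⁺ S P? P-resp (complete u p) p))
      , refl

  sorted? : (u : Config m n) → Dec (Sorted u)
  sorted? u =
    Fin.all? (λ i → Fin.all? λ i′ → ¬? (isSink? {m} {n} (inj₁ i)) →-dec ¬? (isSink? {m} {n} (inj₁ i′))
      →-dec (i Fin.≤? i′) →-dec (u (inj₁ i) ℤ.≤? u (inj₁ i′)))
    ×-dec
    Fin.all? (λ j → Fin.all? λ j′ → (j Fin.≤? j′) →-dec (u (inj₂ j) ℤ.≤? u (inj₂ j′)))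

  ParkingSorted-resp-≗ : {u v : Config m n} → u ≗ v → ParkingSorted u → ParkingSorted v
  ParkingSorted-resp-≗ u≗v (parking , sortedᴬ , sortedᴮ) = Parking-resp-≗ u≗v parking ,
    (λ i i′ ¬s ¬s′ i≤i′ → subst₂ ℤ._≤_ (u≗v (inj₁ i)) (u≗v (inj₁ i′)) (sortedᴬ i i′ ¬s ¬s′ i≤i′)) ,
    (λ j j′ j≤j′ → subst₂ ℤ._≤_ (u≗v (inj₂ j)) (u≗v (inj₂ j′)) (sortedᴮ j j′ j≤j′))

  vertexBound : ∃ λ B → ∑ {m} {n} (λ _ → 1ℤ) ℤ.≤ + B
  vertexBound = bounded-by-ℕ (∑ {m} {n} (λ _ → 1ℤ))

  -- A vertex that burns has fewer grains than neighbours, hence fewer than there are vertices.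
  parking-bound : {u : Config m n} → Parking u → ∀ c → ¬ IsSink c → u c ℤ.≤ + proj₁ vertexBound
  parking-bound p c c≢sink = let burnable ord _ burns = parking⇒burnable p in
    ℤ.<⇒≤ (ℤ.<-≤-trans (burns c c≢sink) (ℤ.≤-trans
      (∑-mono λ c′ → term (adjacent c c′) (does (ord c′ ℤ.<? ord c))) (proj₂ vertexBound)))
    where
    term : ∀ a b → indicator a * indicator b ℤ.≤ 1ℤ
    term true  b = ℤ.≤-trans (ℤ.≤-reflexive (ℤ.*-identityˡ (indicator b))) (indicator≤1 b)
    term false b = ℤ.≤-trans (ℤ.≤-reflexive (ℤ.*-zeroˡ (indicator b))) (ℤ.+≤+ ℕ.z≤n)

-- Finiteness of the parking configurations of a given degree.

module _ {m n : ℕ} where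

  atSink : Vertex (ℕ.suc m) n → ℤ
  atSink c = indicator (does (c ≟ sink))

  atSink-on : ∀ {c} → IsSink c → atSink c ≡ 1ℤ
  atSink-on {c} s with c ≟ sink
  ... | yes _ = refl
  ... | no c≢ = contradiction (sink-unique s sink-isSink) c≢

  atSink-off : ∀ {c} → ¬ IsSink c → atSink c ≡ 0ℤ
  atSink-off {c} ¬s with c ≟ sink
  ... | yes refl = contradiction sink-isSink ¬s
  ... | no _     = refl

  -- The sink value, the only unbounded coordinate, is recovered from the degree.
  withDegree : ℤ → Config (ℕ.suc m) n → Config (ℕ.suc m) n
  withDegree D f c = f c + (D - degree f) * atSink c

  clearSink : Config (ℕ.suc m) n → Config (ℕ.suc m) n
  clearSink u c = u c - u sink * atSink c

  withDegree-clearSink : ∀ u {g} → clearSink u ≗ g → u ≗ withDegree (degree u) g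
  withDegree-clearSink u {g} clear≗g c = sym (trans
    (cong₂ (λ x y → x + (degree u - y) * atSink c) (sym (clear≗g c)) degree-g)
    (eq (u c) (u sink) (degree u) (atSink c)))
    where
    degree-g : degree g ≡ degree u - u sink
    degree-g = trans (∑-cong (sym ∘ clear≗g))
      (trans (∑-- u (λ c → u sink * atSink c)) (cong (_-_ (degree u)) (∑-δ (λ _ → u sink) (sink {m} {n}))))
    eq : ∀ x s d a → (x - s * a) + (d - (d - s)) * a ≡ x
    eq = solve-∀

  clearSink-on : ∀ u {c} → IsSink c → clearSink u c ≡ 0ℤ
  clearSink-on u {c} s = trans
    (cong₂ (λ x a → x - u sink * a) (cong u (sink-unique s sink-isSink)) (atSink-on s)) (eq (u sink))
    where
    eq : ∀ x → x - x * 1ℤ ≡ 0ℤ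
    eq = solve-∀

  clearSink-off : ∀ u {c} → ¬ IsSink c → clearSink u c ≡ u c
  clearSink-off u {c} ¬s = trans (cong (λ x → u c - u sink * x) (atSink-off ¬s)) (eq (u c) (u sink))
    where
    eq : ∀ x y → x - y * 0ℤ ≡ x
    eq = solve-∀

  parkingCandidates : ℤ → List (Config (ℕ.suc m) n)
  parkingCandidates D = List.map (withDegree D) (box (proj₁ (vertexBound {ℕ.suc m} {n})))

  parking-candidate : ∀ {u D} → Parking u → degree u ≡ D → Any (u ≗_) (parkingCandidates D)
  parking-candidate {u} parking refl =
    let g , g∈box , clear≗g = ∈-box (proj₁ (vertexBound {ℕ.suc m} {n}))
                                (λ c → nonneg c (isSink? c)) (λ c → bounded c (isSink? c))
    in  lose (∈-map⁺ (withDegree (degree u)) g∈box) (withDegree-clearSink u clear≗g)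
    where
    nonneg : ∀ c → Dec (IsSink c) → 0ℤ ℤ.≤ clearSink u c
    nonneg c (yes s) = ℤ.≤-reflexive (sym (clearSink-on u s))
    nonneg c (no ¬s) = subst (0ℤ ℤ.≤_) (sym (clearSink-off u ¬s)) (proj₁ parking c ¬s)
    bounded : ∀ c → Dec (IsSink c) → clearSink u c ℤ.≤ + proj₁ (vertexBound {ℕ.suc m} {n})
    bounded c (yes s) = subst (ℤ._≤ + proj₁ (vertexBound {ℕ.suc m} {n})) (sym (clearSink-on u s)) (ℤ.+≤+ ℕ.z≤n)
    bounded c (no ¬s) = subst (ℤ._≤ + proj₁ (vertexBound {ℕ.suc m} {n})) (sym (clearSink-off u ¬s))
                              (parking-bound parking c ¬s)

-- The coefficients and the duality that exchanges exponents.

module _ {m′ n′ : ℕ} where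
  private
    m = ℕ.suc m′
    n = ℕ.suc n′

  HasMonomial-resp-≗ : ∀ {u v : Config m n} {i j} → u ≗ v → HasMonomial u i j → HasMonomial v i j
  HasMonomial-resp-≗ {u} {v} u≗v h =
    let minᵢ , minⱼ = hasMonomial⇒ {u = u} h
    in  ⇒hasMonomial {u = v} (minimum-resp-≃ {u = κ- u} {v = κ- v} (-κ-≃ (≗⇒≃ u≗v)) minᵢ)
                             (minimum-resp-≃ {u = u} {v = v} (≗⇒≃ u≗v) minⱼ)

  Summand : ℕ → ℕ → Config m n → Set
  Summand i j u = ParkingSorted u × HasMonomial u i j

  -- The rank cancels in the difference of the exponents, so they determine the degree, which
  -- confines the summands to a finite list of candidates.
  summand-degree : ∀ {u : Config m n} {i j} → HasMonomial u i j →
                   degree u ≡ (+ m - 1ℤ) * (+ n - 1ℤ) + (+ j - 1ℤ) - + i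
  summand-degree {u} {i} {j} (r , _ , x≡i , y≡j) = trans
    (eq ((+ m - 1ℤ) * (+ n - 1ℤ)) r (degree u))
    (cong₂ (λ y x → (+ m - 1ℤ) * (+ n - 1ℤ) + (y - 1ℤ) - x) y≡j x≡i)
    where
    eq : ∀ g r d → d ≡ g + ((r + 1ℤ) - 1ℤ) - (g + r - d)
    eq = solve-∀

  coefficient : ∀ i j → ∃ (Count (Summand i j))
  coefficient i j = finite-count
    (λ u → (parking? u ×-dec sorted? u) ×-dec hasMonomial? u i j)
    (λ u≗v (p , h) → ParkingSorted-resp-≗ u≗v p , HasMonomial-resp-≗ u≗v h)
    (parkingCandidates ((+ m - 1ℤ) * (+ n - 1ℤ) + (+ j - 1ℤ) - + i))
    (λ u (p , h) → parking-candidate (proj₁ p) (summand-degree {u} h))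

  -- A relation, so that the transfer of exponents and injectivity hold for every choice of sorting
  -- permutation.
  record Dual (u v : Config m n) : Set where
    constructor dual
    field
      σ  : Symmetry m n
      κ≃ : ((κ- u) ∘ permute σ) ≃ v

  -- The equivalence of `Dual` is reflected through `κ`, which `σ` fixes.
  dual-≃ : ∀ {u v} (d : Dual u v) → (u ∘ permute (Dual.σ d)) ≃ (κ- v)
  dual-≃ {u} (dual σ κ≃) = ≃-trans
    (≗⇒≃ λ c → trans (eq (κ c) (u (permute σ c)))
                     (cong (λ k → κ c - (k - u (permute σ c))) (sym (κ-permute σ c))))
    (-κ-≃ κ≃)
    where
    eq : ∀ k x → x ≡ k - (k - x)
    eq = solve-∀

  dual-exists : ∀ u → ∃ λ v → ParkingSorted v × Dual u v
  dual-exists u =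
    let p , parking , κ≃p = parkingRepresentative (κ- u)
    in  dual-from p parking κ≃p
    where
    dual-from : ∀ p → Parking p → (κ- u) ≃ p → ∃ λ v → ParkingSorted v × Dual u v
    dual-from p parking κ≃p =
      let σ , sorted = sort p
      in  p ∘ permute σ , (parking-permute σ {p} parking , sorted) , dual σ (≃-permute σ κ≃p)

  dual-monomial : ∀ {u v i j} → Dual u v → HasMonomial u i j → HasMonomial v j i
  dual-monomial {u} {v} d@(dual σ κ≃) h =
    let minᵢ , minⱼ = hasMonomial⇒ {u = u} h
    in  ⇒hasMonomial {u = v} (minimum-resp-≃ {v = κ- v} (dual-≃ d) (minimum-permute σ {u} minⱼ))
                             (minimum-resp-≃ {v = v} κ≃ (minimum-permute σ {κ- u} minᵢ))

  dual-injective : ∀ {u u′ v v′} → ParkingSorted u → ParkingSorted u′ →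
                   Dual u v → Dual u′ v′ → v ≗ v′ → u ≗ u′
  dual-injective {u} {u′} {v} {v′} (parking , sorted) (parking′ , sorted′)
                 d@(dual σ _) d′@(dual σ′ _) v≗v′ c =
    sym (sorted-permuted-≗ τ {u′} {u} sorted′ sorted
      (parking-unique parking′ (parking-permute τ {u} parking) u′≃u∘τ) c)
    where
    -- `v ≗ v′` makes `u` after `σ` equivalent to `u′` after `σ′`; precomposing with the inverse of
    -- `σ′` leaves `u′` alone on one side.
    τ = σ ∙ inverse σ′
    u∘σ≃u′∘σ′ : (u ∘ permute σ) ≃ (u′ ∘ permute σ′)
    u∘σ≃u′∘σ′ = ≃-trans (dual-≃ d) (≃-trans (-κ-≃ (≗⇒≃ v≗v′)) (≃-sym (dual-≃ d′)))
    u′≃u∘τ : u′ ≃ (u ∘ permute τ)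
    u′≃u∘τ = ≃-sym (≃-trans (≗⇒≃ λ c → cong u (permute-∙ σ (inverse σ′) c))
      (≃-trans (≃-permute (inverse σ′) u∘σ≃u′∘σ′)
               (≗⇒≃ λ c → cong u′ (permute-inverseʳ σ′ c))))

  -- The duality only has to be injective: the same bound with `i` and `j` exchanged is the opposite
  -- inequality.
  coefficient-≤ : ∀ i j → proj₁ (coefficient i j) ℕ.≤ proj₁ (coefficient j i)
  coefficient-≤ i j = Count-injection (proj₂ (coefficient i j)) (proj₂ (coefficient j i))
    (λ u (_ , h) → let v , p , d = dual-exists u in v , p , dual-monomial {u} {v} d h)
    (λ {u} {v} (p , _) (q , _) → dual-injective p q
      (proj₂ (proj₂ (dual-exists u))) (proj₂ (proj₂ (dual-exists v))))

theorem14p1 : ∀ (m n : ℕ) → 1 ≤ m → 1 ≤ n →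
    ∃ λ (K : PowerSeries) → IsK m n K × (∀ i j → K i j ≡ K j i)
theorem14p1 (ℕ.suc m) (ℕ.suc n) _ _ =
  (λ i j → proj₁ (coefficient {m} {n} i j)) ,
  ((λ u _ → monomial u) , λ i j → proj₂ (coefficient {m} {n} i j)) ,
  λ i j → ℕ.≤-antisym (coefficient-≤ {m} {n} i j) (coefficient-≤ {m} {n} j i)
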